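{- Let $n\ge2$ and consider the cycle graph on nodes $0,1,\dots,n$, where node $i$ is adjacent to nodes $(i-1)\bmod (n+1)$ and $(i+1)\bmod (n+1)$, with starting node $X_0=0$. Then $$\mathbb E_{\pi_{neg}}[T_C]<\tfrac12 (n+1)n=\mathbb E_{\pi_{rw}}[T_C].$$
   Context: $T_C$ is the smallest $m$ such that $X_0,\dots,X_m$ visit all nodes of the graph. Random walk $\pi_{rw}$: if $X_m=i$, $X_{m+1}$ is a uniformly random neighbour of $i$, independently of the past. Negative feedback $\pi_{neg}$: for an edge from $i$ to $j$, let $N_{ij}^{(m)}$ be the number of times $t<m$ with $X_t=i,X_{t+1}=j$. Let $Smin_i^{(m)}$ be the set of neighbours $j$ of $i$ minimizing $N_{ij}^{(m)}$. If $X_m=i$, then given the past, $X_{m+1}$ is uniformly distributed on $Smin_i^{(m)}$. -}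

module Defs where

open import Data.Nat as ℕ using (ℕ; zero; suc; _+_; _≤ᵇ_)
open import Data.Nat.DivMod using (_mod_)
open import Data.Fin as Fin using (Fin; toℕ)
open import Data.Bool using (Bool; true; false; if_then_else_; _∧_; not)
open import Data.List using (List; []; _∷_; [_]; map; concatMap; filterᵇ; allFin; length; upTo)
open import Data.Product using (_×_; _,_; Σ; ∃)
open import Data.Integer using (+_)
open import Data.Rational using (ℚ; 0ℚ; 1ℚ; _/_; _*_; _-_; ∣_∣; _<_; _≤_)
import Data.Rational as ℚ
open import Relation.Nullary.Decidable using (⌊_⌋)
open import Data.Bool.ListAction using (all; any)

Node : ℕ → Set
Node n = Fin (suc n)

succC : ∀ {n} → Node n → Node n
succC {n} i = (toℕ i + 1) mod (suc n)

predC : ∀ {n} → Node n → Node n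
predC {n} i = (toℕ i + n) mod (suc n)

-- neighbours of i: (i-1) mod (n+1) and (i+1) mod (n+1)  (distinct for n ≥ 2)
nbrs : ∀ {n} → Node n → List (Node n)
nbrs i = predC i ∷ succC i ∷ []

-- A history X_0,…,X_m is stored REVERSED: X_m ∷ X_{m-1} ∷ … ∷ X_0 ∷ [].
History : ℕ → Set
History n = List (Node n)

-- A (uniform-choice) policy: given the history, the set (list) of
-- candidates; X_{m+1} is uniform on it.
Policy : ℕ → Set
Policy n = History n → List (Node n)

πrw : ∀ {n} → Policy n
πrw []      = []
πrw (i ∷ _) = nbrs i

Ncount : ∀ {n} → History n → Node n → Node n → ℕ
Ncount (y ∷ x ∷ rest) i j =
  (if ⌊ x Fin.≟ i ⌋ ∧ ⌊ y Fin.≟ j ⌋ then 1 else 0) + Ncount (x ∷ rest) i j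
Ncount _ i j = 0

Smin : ∀ {n} → History n → Node n → List (Node n)
Smin h i = filterᵇ (λ j → all (λ k → Ncount h i j ≤ᵇ Ncount h i k) (nbrs i)) (nbrs i)

πneg : ∀ {n} → Policy n
πneg []        = []
πneg h@(i ∷ _) = Smin h i

Dist : ℕ → Set
Dist n = List (History n × ℚ)

uniformWeight : ∀ {A : Set} → List A → ℚ
uniformWeight []       = 0ℚ
uniformWeight (x ∷ xs) = + 1 / suc (length xs)

step : ∀ {n} → Policy n → Dist n → Dist n
step π d = concatMap (λ { (h , q) → map (λ j → (j ∷ h , q * uniformWeight (π h))) (π h) }) d

pathLaw : ∀ {n} → Policy n → ℕ → Dist n
pathLaw π zero    = [ (Fin.zero ∷ [] , 1ℚ) ]
pathLaw π (suc m) = step π (pathLaw π m)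

covers : ∀ {n} → History n → Bool
covers {n} h = all (λ v → any (λ w → ⌊ v Fin.≟ w ⌋) h) (allFin (suc n))

sumℚ : List ℚ → ℚ
sumℚ []       = 0ℚ
sumℚ (x ∷ xs) = x ℚ.+ sumℚ xs

-- P(T_C > m) = P(X_0,…,X_m do not visit all nodes)
tailProb : ∀ {n} → Policy n → ℕ → ℚ
tailProb π m = sumℚ (map (λ { (h , q) → if covers h then 0ℚ else q }) (pathLaw π m))

-- partial sums  Σ_{m<M} P(T_C > m);  E[T_C] = Σ_{m≥0} P(T_C > m)
partialE : ∀ {n} → Policy n → ℕ → ℚ
partialE π M = sumℚ (map (tailProb π) (upTo M))

ConvergesTo : (ℕ → ℚ) → ℚ → Set
ConvergesTo s L = (ε : ℚ) → 0ℚ < ε → ∃ λ M → (M' : ℕ) → M ℕ.≤ M' → ∣ s M' - L ∣ < ε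

ExpectedCoverTime : ∀ {n} → Policy n → ℚ → Set
ExpectedCoverTime π L = ConvergesTo (partialE π) L

-- Seen from the walker, the visited nodes form an arc.
--
-- Random walk: gambler's ruin on the arc gives an explicit expected remaining cover time V with
-- V = 1 + P V on the uncovered states.  Since V is bounded, the error after M steps is at most
-- C · P(T_C > M), and P(T_C > M), being decreasing and summable, is O(1/M).
--
-- Negative feedback: the exits of a node towards its two neighbours differ by at most one, and the
-- differences determine the elapsed time through a quadratic form.  Hence T_C is bounded and each
-- state is visited at most once.  The probability that a state is ever visited is explicit, 2⁻ᵏ
-- or 2⁻ᵏ⁻¹ for an arc of k + 1 nodes, which is verified by the balance equation G = δ + G P.
-- Summing it over the states with an arc of k nodes gives (k + 1)/2, compared with k for the
-- random walk.
module Submission where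

open import Defs
open import Data.Bool using (Bool; true; false; if_then_else_; _∧_)
open import Data.Bool.ListAction using (any; all)
open import Data.Bool.Properties using (T-≡; ¬-not)
open import Data.Fin as Fin using (zero; toℕ)
open import Data.Integer as ℤ using (ℤ; +_; -[1+_]; 0ℤ)
import Data.Integer.Properties as ℤ
import Data.Integer.Tactic.RingSolver as ℤ-Solver
open import Data.List as List using (List; []; _∷_; _++_; map; upTo; applyUpTo; allFin)
open import Data.List.Membership.Propositional using (_∈_; _∉_)
open import Data.List.Membership.Propositional.Properties using (∈-allFin)
open import Data.List.Properties using (map-++; map-cong; map-upTo)
import Data.List.Relation.Unary.All as All
import Data.List.Relation.Unary.All.Properties as All
open import Data.List.Relation.Unary.Any as Any using (here; there)
import Data.List.Relation.Unary.Any.Properties as Any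
open import Data.Nat as ℕ using (ℕ; zero; suc; _≤ᵇ_; z≤n; s≤s)
open import Data.Nat.GeneralisedArithmetic using (fold)
import Data.Nat.Properties as ℕ
import Data.Nat.Tactic.RingSolver as ℕ-Solver
open import Data.Product using (Σ; ∃; _×_; _,_; proj₁; proj₂)
open import Data.Sum using (_⊎_; inj₁; inj₂; swap)
open import Data.Unit using (⊤; tt)
open import Data.Vec using (Vec; []; _∷_)
open import Function using (_∘_; id; Equivalence)
open import Relation.Binary.PropositionalEquality
open import Relation.Nullary using (yes; no; contradiction)
open import Relation.Nullary.Decidable using (⌊_⌋; toWitness; fromWitness; from-yes; dec⇒maybe)
open import Tactic.RingSolver using (solve-∀)
open import Tactic.RingSolver.Core.AlmostCommutativeRing using (AlmostCommutativeRing; fromCommutativeRing)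

-- The negative feedback walk is not Markov in its position. Away from the walker, however, every
-- visited node was last left towards the walker, so the future depends on one bit per visited node
-- and on the lean of the walker's own node. A balanced exit leaves the bit `true` and a forced exit
-- the bit `false`; this is where the powers of one half in G come from. G is never tabulated over
-- states: `total` pairs it with an observable. With e m the pairing of G with the probability of
-- surviving m more steps, the balance equation reads e m = P(T_C > m) + e (m+1). Telescoping and e
-- ≥ 0 give E[T_C] ≤ e 0, the total mass of G on uncovered states, and this mass is compared with
-- n(n+1)/2 one arc size at a time. The bound on T_C makes the partial sums eventually constant, so
-- that the limit is a rational number. The random walk telescopes in the same way with e m = P^m V,
-- but there e m has to be shown to tend to 0.

module Cycle where
  open import Data.Nat using (_+_; _≤_; _<_; _∸_; _%_; pred)
  open import Data.Nat.Properties
  open import Data.Nat.DivMod using (_mod_; %-distribˡ-+; [m+n]%n≡m%n; m<n⇒m%n≡m; m%n<n)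
  open import Data.Fin.Properties using (toℕ-fromℕ<; toℕ-injective; toℕ<n)
  open ≡-Reasoning

  -- Rotations of the cycle

  fold-shift : ∀ {A : Set} (g : A → A) x j → fold (g x) g j ≡ g (fold x g j)
  fold-shift g x zero    = refl
  fold-shift g x (suc j) = cong g (fold-shift g x j)

  fold-+ : ∀ {A : Set} (g : A → A) x i j → fold (fold x g i) g j ≡ fold x g (j + i)
  fold-+ g x i zero    = refl
  fold-+ g x i (suc j) = cong g (fold-+ g x i j)

  fold-cancel : ∀ {A : Set} {g g' : A → A} → (∀ x → g (g' x) ≡ x) → ∀ x j → fold (fold x g' j) g j ≡ x
  fold-cancel                  inv x zero    = refl
  fold-cancel {g = g} {g' = g'} inv x (suc j) =
    trans (sym (fold-shift g (g' (fold x g' j)) j)) (trans (cong (λ y → fold y g j) (inv _)) (fold-cancel inv x j))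

  -- Both directions of travel satisfy this interface, so every argument about forward steps also
  -- serves for backward steps. In `aperiodic`, `suc j` ranges over 1, ..., n, the nontrivial
  -- rotations.
  record Rotation {n} (g g' : Node n → Node n) : Set where
    field
      inverseˡ   : ∀ x → g' (g x) ≡ x
      inverseʳ   : ∀ x → g (g' x) ≡ x
      aperiodic  : ∀ x j → j < n → fold x g (suc j) ≢ x
      periodic   : ∀ x → fold x g (suc n) ≡ x
      transitive : ∀ x v → ∃ λ j → j ≤ n × v ≡ fold x g j

  rotation-succ : ∀ {n} → Rotation {n} succC predC
  rotation-succ {n} = record
    { inverseˡ   = λ x → toℕ-injective (trans (toℕ-pred (succC x)) (trans (cong (λ k → (k + n) % suc n) (toℕ-succ x)) (cancel x 1 n (+-comm n 1))))
    ; inverseʳ   = λ x → toℕ-injective (trans (toℕ-succ (predC x)) (trans (cong (λ k → (k + 1) % suc n) (toℕ-pred x)) (cancel x n 1 refl)))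
    ; aperiodic  = λ x j j<n eq → aperiodic x j j<n (trans (sym (toℕ-fold x (suc j))) (cong toℕ eq))
    ; periodic   = λ x → toℕ-injective (trans (toℕ-fold x (suc n)) (trans ([m+n]%n≡m%n (toℕ x) (suc n)) (small x)))
    ; transitive = transitive
    }
    where
    N = suc n
    toℕ-mod : ∀ k → toℕ (k mod N) ≡ k % N
    toℕ-mod k = toℕ-fromℕ< (m%n<n k N)
    toℕ-succ : ∀ x → toℕ (succC x) ≡ (toℕ x + 1) % N
    toℕ-succ x = toℕ-mod (toℕ x + 1)
    toℕ-pred : ∀ (x : Node n) → toℕ (predC x) ≡ (toℕ x + n) % N
    toℕ-pred x = toℕ-mod (toℕ x + n)
    small : ∀ (x : Node n) → toℕ x % N ≡ toℕ x
    small x = m<n⇒m%n≡m (toℕ<n x)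
    absorb : ∀ a b → (a % N + b) % N ≡ (a + b) % N
    absorb a b = begin
      (a % N + b) % N              ≡⟨ %-distribˡ-+ (a % N) b N ⟩
      (a % N % N + b % N) % N      ≡⟨ cong (λ c → (c + b % N) % N) (m<n⇒m%n≡m (m%n<n a N)) ⟩
      (a % N + b % N) % N          ≡⟨ %-distribˡ-+ a b N ⟨
      (a + b) % N                  ∎
    cancel : ∀ (x : Node n) a b → b + a ≡ N → ((toℕ x + a) % N + b) % N ≡ toℕ x
    cancel x a b eq = begin
      ((toℕ x + a) % N + b) % N    ≡⟨ absorb (toℕ x + a) b ⟩
      (toℕ x + a + b) % N          ≡⟨ cong (_% N) (+-assoc (toℕ x) a b) ⟩
      (toℕ x + (a + b)) % N        ≡⟨ cong (λ c → (toℕ x + c) % N) (trans (+-comm a b) eq) ⟩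
      (toℕ x + N) % N              ≡⟨ [m+n]%n≡m%n (toℕ x) N ⟩
      toℕ x % N                    ≡⟨ small x ⟩
      toℕ x                        ∎
    toℕ-fold : ∀ x j → toℕ (fold x succC j) ≡ (toℕ x + j) % N
    toℕ-fold x zero    = sym (trans (cong (_% N) (+-identityʳ (toℕ x))) (small x))
    toℕ-fold x (suc j) = begin
      toℕ (succC (fold x succC j))      ≡⟨ toℕ-succ (fold x succC j) ⟩
      (toℕ (fold x succC j) + 1) % N    ≡⟨ cong (λ c → (c + 1) % N) (toℕ-fold x j) ⟩
      ((toℕ x + j) % N + 1) % N         ≡⟨ absorb (toℕ x + j) 1 ⟩
      (toℕ x + j + 1) % N               ≡⟨ cong (_% N) (+-assoc (toℕ x) j 1) ⟩
      (toℕ x + (j + 1)) % N             ≡⟨ cong (λ c → (toℕ x + c) % N) (+-comm j 1) ⟩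
      (toℕ x + suc j) % N               ∎
    aperiodic : ∀ (x : Node n) j → j < n → (toℕ x + suc j) % N ≢ toℕ x
    aperiodic x j j<n eq with toℕ x + suc j ℕ.<? N
    ... | yes lt = m≢1+m+n (toℕ x) (trans (sym eq) (trans (m<n⇒m%n≡m lt) (+-suc (toℕ x) j)))
    -- After wrapping once, a return to x would force `suc j` to be a full turn.
    ... | no ¬lt = <-irrefl wrapped (+-monoʳ-< (toℕ x) (s≤s j<n))
      where
      d = toℕ x + suc j ∸ N
      d+N : d + N ≡ toℕ x + suc j
      d+N = m∸n+n≡m (≮⇒≥ ¬lt)
      d<N : d < N
      d<N = +-cancelʳ-< N d N (subst (_< N + N) (sym d+N) (+-mono-< (toℕ<n x) (s≤s j<n)))
      wrapped : toℕ x + suc j ≡ toℕ x + N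
      wrapped = trans (sym d+N) (cong (_+ N) (trans (sym (trans (cong (_% N) (sym d+N)) (trans ([m+n]%n≡m%n d N) (m<n⇒m%n≡m d<N)))) eq))
    transitive : ∀ (x v : Node n) → ∃ λ j → j ≤ n × v ≡ fold x succC j
    transitive x v = j , ℕ.s≤s⁻¹ (m%n<n (N ∸ toℕ x + toℕ v) N) , toℕ-injective (sym (trans (toℕ-fold x j) reach))
      where
      -- The difference v - x modulo N, with N added first to stay in ℕ.
      j = (N ∸ toℕ x + toℕ v) % N
      reach : (toℕ x + j) % N ≡ toℕ v
      reach = begin
        (toℕ x + j) % N                       ≡⟨ cong (_% N) (+-comm (toℕ x) j) ⟩
        (j + toℕ x) % N                       ≡⟨ absorb (N ∸ toℕ x + toℕ v) (toℕ x) ⟩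
        (N ∸ toℕ x + toℕ v + toℕ x) % N       ≡⟨ cong (_% N) (rearrange (N ∸ toℕ x) (toℕ v) (toℕ x)) ⟩
        (toℕ v + (N ∸ toℕ x + toℕ x)) % N     ≡⟨ cong (λ c → (toℕ v + c) % N) (m∸n+n≡m (<⇒≤ (toℕ<n x))) ⟩
        (toℕ v + N) % N                       ≡⟨ [m+n]%n≡m%n (toℕ v) N ⟩
        toℕ v % N                             ≡⟨ small v ⟩
        toℕ v                                 ∎
        where
        rearrange : ∀ a b c → a + b + c ≡ b + (a + c)
        rearrange = ℕ-Solver.solve-∀

  module _ {n} {g g' : Node n → Node n} (ρ : Rotation g g') where
    open Rotation ρ

    unwind : ∀ {x y} j → y ≡ fold x g' j → fold y g j ≡ x
    unwind {x} j refl = fold-cancel inverseʳ x j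

    complement : ∀ x i j → i + j ≡ suc n → fold x g i ≡ fold x g' j
    complement x i j i+j = begin
      fold x g i                            ≡⟨ fold-cancel {g = g'} {g' = g} inverseˡ (fold x g i) j ⟨
      fold (fold (fold x g i) g j) g' j     ≡⟨ cong (λ y → fold y g' j) (fold-+ g x i j) ⟩
      fold (fold x g (j + i)) g' j          ≡⟨ cong (λ k → fold (fold x g k) g' j) (trans (+-comm j i) i+j) ⟩
      fold (fold x g (suc n)) g' j          ≡⟨ cong (λ y → fold y g' j) (periodic x) ⟩
      fold x g' j                           ∎

    reverse : Rotation g' g
    reverse = record
      { inverseˡ   = inverseʳ
      ; inverseʳ   = inverseˡ
      ; aperiodic  = λ x j j<n eq → aperiodic x j j<n (unwind (suc j) (sym eq))
      ; periodic   = λ x → trans (sym (cong (λ y → fold y g' (suc n)) (periodic x))) (fold-cancel {g = g'} {g' = g} inverseˡ x (suc n))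
      ; transitive = transitive′
      }
      where
      transitive′ : ∀ x v → ∃ λ j → j ≤ n × v ≡ fold x g' j
      transitive′ x v with transitive x v
      ... | zero  , _   , eq = zero , z≤n , eq
      ... | suc j , j≤n , eq = n ∸ j , m∸n≤m n j , trans eq (complement x (suc j) (n ∸ j) (cong suc (m+[n∸m]≡n (<⇒≤ j≤n))))

    g≢id : 0 < n → ∀ x → g x ≢ x
    g≢id 0<n x = aperiodic x 0 0<n

    g≢g' : 1 < n → ∀ x → g x ≢ g' x
    g≢g' 1<n x eq = aperiodic x 1 1<n (trans (cong g eq) (inverseʳ x))

  -- The visited nodes as an arc

  covers-true : ∀ {n} {h : History n} → (∀ v → v ∈ h) → covers h ≡ true
  covers-true {n} {h} all∈ = Equivalence.to T-≡ (All.all⁻ (λ v → any (λ w → ⌊ v Fin.≟ w ⌋) h)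
    (All.universal (λ v → Any.any⁺ (λ w → ⌊ v Fin.≟ w ⌋) (Any.map fromWitness (all∈ v))) (allFin (suc n))))

  covers-sound : ∀ {n} {h : History n} → covers h ≡ true → ∀ v → v ∈ h
  covers-sound {n} {h} eq v =
    Any.map toWitness (Any.any⁻ (λ w → ⌊ v Fin.≟ w ⌋) h
      (All.lookup (All.all⁺ (λ v → any (λ w → ⌊ v Fin.≟ w ⌋) h) (allFin (suc n)) (Equivalence.from T-≡ eq)) (∈-allFin v)))

  -- The visited nodes, seen from the walker's position x: l nodes on its g'-side and r nodes on its g-side.
  record Arc {n} (g g' : Node n → Node n) (h : History n) (x : Node n) (l r : ℕ) : Set where
    field
      sound    : ∀ {v} → v ∈ h → (∃ λ j → j ≤ r × v ≡ fold x g j) ⊎ (∃ λ j → j ≤ l × v ≡ fold x g' j)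
      ahead    : ∀ j → j ≤ r → fold x g j ∈ h
      behind   : ∀ j → j ≤ l → fold x g' j ∈ h

  open Arc

  arc-start : ∀ {n} {g g' : Node n → Node n} {x} → Arc g g' (x ∷ []) x 0 0
  arc-start .sound (here eq)       = inj₁ (0 , z≤n , eq)
  arc-start .ahead .zero z≤n  = here refl
  arc-start .behind .zero z≤n = here refl

  mirror : ∀ {n} {g g' : Node n → Node n} {h x l r} → Arc g g' h x l r → Arc g' g h x r l
  mirror A .sound  = swap ∘ sound A
  mirror A .ahead  = behind A
  mirror A .behind = ahead A

  module _ {n} {g g' : Node n → Node n} (ρ : Rotation g g') where
    open Rotation ρ

    -- `pred r` lets one statement cover both a step inside the arc and a step to a new node, where
    -- r remains 0.
    advance : ∀ {h x l r} → Arc g g' h x l r → Arc g g' (g x ∷ h) (g x) (suc l) (pred r)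
    advance A .sound (here eq) = inj₁ (0 , z≤n , eq)
    advance {x = x} A .sound (there v∈h) with sound A v∈h
    ... | inj₁ (zero  , _   , eq) = inj₂ (1 , s≤s z≤n , trans eq (sym (inverseˡ x)))
    ... | inj₁ (suc j , s≤s j≤r , eq) = inj₁ (j , j≤r , trans eq (sym (fold-shift g x j)))
    ... | inj₂ (j     , j≤l , eq) = inj₂ (suc j , s≤s j≤l , trans eq (trans (cong (λ y → fold y g' j) (sym (inverseˡ x))) (fold-shift g' (g x) j)))
    advance A .ahead zero _ = here refl
    advance {x = x} {r = suc r} A .ahead (suc j) j≤r =
      there (subst (_∈ _) (sym (fold-shift g x (suc j))) (ahead A (suc (suc j)) (s≤s j≤r)))
    advance A .behind zero _ = here refl
    advance {x = x} A .behind (suc j) (s≤s j≤l) =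
      there (subst (_∈ _) (trans (cong (λ y → fold y g' j) (sym (inverseˡ x))) (fold-shift g' (g x) j)) (behind A j j≤l))

    -- If the node just past the end were already on the arc, a rotation by at most l + r + 1 ≤ n
    -- steps would have a fixed point.
    beyond-arc : ∀ {h x l r} → Arc g g' h x l r → l + r < n → fold x g (suc r) ∉ h
    beyond-arc {x = x} {l} {r} A l+r<n v∈h with sound A v∈h
    ... | inj₁ (j , j≤r , eq) = aperiodic (fold x g j) (r ∸ j) (≤-<-trans (m∸n≤m r j) (≤-<-trans (m≤n+m r l) l+r<n))
            (trans (fold-+ g x j (suc (r ∸ j))) (trans (cong (fold x g ∘ suc) (m∸n+n≡m j≤r)) eq))
    ... | inj₂ (j , j≤l , eq) = aperiodic x (j + r) (≤-<-trans (+-monoˡ-≤ r j≤l) l+r<n)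
            (trans (sym (trans (fold-+ g x (suc r) j) (cong (fold x g) (+-suc j r)))) (unwind ρ j eq))

    covers-full : ∀ {h x l r} → Arc g g' h x l r → l + r ≡ n → covers h ≡ true
    covers-full {h} {x} {l} {r} A l+r≡n = covers-true visited
      where
      visited : ∀ v → v ∈ h
      visited v with transitive x v
      ... | j , j≤n , refl with j ℕ.≤? r
      ...   | yes j≤r = ahead A j j≤r
      -- More than r steps ahead means at most l steps behind, going round the other way.
      ...   | no  j≰r = subst (_∈ h) (sym (complement ρ x j (suc n ∸ j) (m+[n∸m]≡n (m≤n⇒m≤1+n j≤n))))
                (behind A (suc n ∸ j) (≤-trans (∸-monoʳ-≤ (suc n) (≰⇒> j≰r)) (≤-reflexive (trans (cong (_∸ r) (sym l+r≡n)) (m+n∸n≡m l r)))))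

    covers-partial : ∀ {h x l r} → Arc g g' h x l r → l + r < n → covers h ≡ false
    covers-partial A l+r<n = ¬-not (λ eq → beyond-arc A l+r<n (covers-sound eq _))

open Cycle
open Arc

open import Data.Rational using (ℚ; mkℚ; 0ℚ; 1ℚ; ½; _+_; _*_; _-_; -_; ∣_∣; _/_; _≤_; _<_; toℚᵘ; *<*; nonNegative)
open import Data.Rational.Properties
open import Data.Rational.Unnormalised as ℚᵘ using (mkℚᵘ; *≡*; *≤*)
import Data.Rational.Unnormalised.Properties as ℚᵘ

-- Tail probabilities as a recursion over histories

ℚ-ring : AlmostCommutativeRing _ _
ℚ-ring = fromCommutativeRing +-*-commutativeRing (λ q → dec⇒maybe (0ℚ ≟ q))

sumℚ-++ : ∀ xs ys → sumℚ (xs ++ ys) ≡ sumℚ xs + sumℚ ys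
sumℚ-++ []       ys = sym (+-identityˡ (sumℚ ys))
sumℚ-++ (x ∷ xs) ys = trans (cong (λ t → x + t) (sumℚ-++ xs ys)) (assoc x (sumℚ xs) (sumℚ ys))
  where
  assoc : ∀ a b c → a + (b + c) ≡ a + b + c
  assoc = solve-∀ ℚ-ring

module _ {n} (π : Policy n) where

  expectNext : (History n → ℚ) → History n → ℚ
  expectNext F h = sumℚ (map (λ j → uniformWeight (π h) * F (j ∷ h)) (π h))

  -- The probability that a walk with history h has not covered the graph after m more steps.
  survival : ℕ → History n → ℚ
  survival zero    h = if covers h then 0ℚ else 1ℚ
  survival (suc m) h = expectNext (survival m) h

  -- `G` and `K` are constrained only pointwise, so that they can be instantiated by
  -- pattern-matching functions on pairs, such as the one in `tailProb`.
  expectation-step : ∀ F (d : Dist n) {G K : History n × ℚ → ℚ} →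
    (∀ h q → G (h , q) ≡ q * F h) → (∀ h q → K (h , q) ≡ q * expectNext F h) →
    sumℚ (map G (step π d)) ≡ sumℚ (map K d)
  expectation-step F []            G≗ K≗ = refl
  expectation-step F ((h , q) ∷ d) {G} {K} G≗ K≗ = begin
    sumℚ (map G (branch (π h) ++ step π d))
      ≡⟨ cong sumℚ (map-++ G (branch (π h)) (step π d)) ⟩
    sumℚ (map G (branch (π h)) ++ map G (step π d))
      ≡⟨ sumℚ-++ (map G (branch (π h))) _ ⟩
    sumℚ (map G (branch (π h))) + sumℚ (map G (step π d))
      ≡⟨ cong₂ _+_ (trans (branches (π h)) (sym (K≗ h q))) (expectation-step F d G≗ K≗) ⟩
    K (h , q) + sumℚ (map K d) ∎
    where
    open ≡-Reasoning
    u = uniformWeight (π h)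
    branch = map (λ j → (j ∷ h , q * u))
    distrib : ∀ q u x s → q * u * x + q * s ≡ q * (u * x + s)
    distrib = solve-∀ ℚ-ring
    branches : ∀ js → sumℚ (map G (branch js)) ≡ q * sumℚ (map (λ j → u * F (j ∷ h)) js)
    branches []       = sym (*-zeroʳ q)
    branches (j ∷ js) = trans (cong₂ _+_ (G≗ (j ∷ h) (q * u)) (branches js)) (distrib q u (F (j ∷ h)) _)

  -- The path law grows at its last step, `survival` unfolds at its first. Steps are transferred one
  -- by one from the law to the observable while m + k stays fixed.
  expectation-pathLaw : ∀ m F {G : History n × ℚ → ℚ} → (∀ h q → G (h , q) ≡ q * F h) →
    ∀ k → (∀ h → F h ≡ survival k h) → sumℚ (map G (pathLaw π m)) ≡ survival (m ℕ.+ k) (zero ∷ [])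
  expectation-pathLaw zero    F {G} G≗ k F≗ = begin
    G (zero ∷ [] , 1ℚ) + 0ℚ   ≡⟨ +-identityʳ _ ⟩
    G (zero ∷ [] , 1ℚ)        ≡⟨ G≗ _ _ ⟩
    1ℚ * F (zero ∷ [])        ≡⟨ *-identityˡ _ ⟩
    F (zero ∷ [])             ≡⟨ F≗ _ ⟩
    survival k (zero ∷ [])    ∎
    where open ≡-Reasoning
  expectation-pathLaw (suc m) F G≗ k F≗ = begin
    _ ≡⟨ expectation-step F (pathLaw π m) {K = λ { (h , q) → q * expectNext F h }} G≗ (λ _ _ → refl) ⟩
    _ ≡⟨ expectation-pathLaw m (expectNext F) (λ _ _ → refl) (suc k)
           (λ h → cong sumℚ (map-cong (λ j → cong (uniformWeight (π h) *_) (F≗ (j ∷ h))) (π h))) ⟩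
    survival (m ℕ.+ suc k) (zero ∷ []) ≡⟨ cong (λ i → survival i (zero ∷ [])) (ℕ.+-suc m k) ⟩
    survival (suc m ℕ.+ k) (zero ∷ []) ∎
    where
    open ≡-Reasoning

  tailProb-survival : ∀ m → tailProb π m ≡ survival m (zero ∷ [])
  tailProb-survival m = trans
    (expectation-pathLaw m (survival 0) weigh 0 (λ _ → refl))
    (cong (λ i → survival i (zero ∷ [])) (ℕ.+-identityʳ m))
    where
    weigh : ∀ h q → (if covers h then 0ℚ else q) ≡ q * survival 0 h
    weigh h q with covers h
    ... | true  = sym (*-zeroʳ q)
    ... | false = sym (*-identityʳ q)

-- Naturals in ℚ, telescoping and convergence

opaque
  ι : ℕ → ℚ
  ι m = + m / 1

  toℚᵘ-ι : ∀ m → toℚᵘ (ι m) ℚᵘ.≃ mkℚᵘ (+ m) 0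
  toℚᵘ-ι m = toℚᵘ-fromℚᵘ (mkℚᵘ (+ m) 0)

  ι-0 : ι 0 ≡ 0ℚ
  ι-0 = refl

  ι-1 : ι 1 ≡ 1ℚ
  ι-1 = refl

ι-+ : ∀ a b → ι (a ℕ.+ b) ≡ ι a + ι b
ι-+ a b = toℚᵘ-injective (ℚᵘ.≃-trans (toℚᵘ-ι (a ℕ.+ b)) (ℚᵘ.≃-trans (*≡* (identity (+ a) (+ b)))
  (ℚᵘ.≃-sym (ℚᵘ.≃-trans (toℚᵘ-homo-+ (ι a) (ι b)) (ℚᵘ.+-cong (toℚᵘ-ι a) (toℚᵘ-ι b))))))
  where
  identity : ∀ a b → (a ℤ.+ b) ℤ.* (+ 1 ℤ.* + 1) ≡ (a ℤ.* + 1 ℤ.+ b ℤ.* + 1) ℤ.* + 1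
  identity = ℤ-Solver.solve-∀

ι-* : ∀ a b → ι (a ℕ.* b) ≡ ι a * ι b
ι-* a b = toℚᵘ-injective (ℚᵘ.≃-trans (toℚᵘ-ι (a ℕ.* b)) (ℚᵘ.≃-trans (*≡* (trans (cong (ℤ._* (+ 1 ℤ.* + 1)) (ℤ.pos-* a b)) (identity (+ a) (+ b))))
  (ℚᵘ.≃-sym (ℚᵘ.≃-trans (toℚᵘ-homo-* (ι a) (ι b)) (ℚᵘ.*-cong (toℚᵘ-ι a) (toℚᵘ-ι b))))))
  where
  identity : ∀ a b → (a ℤ.* b) ℤ.* (+ 1 ℤ.* + 1) ≡ (a ℤ.* b) ℤ.* + 1
  identity = ℤ-Solver.solve-∀

half-ι : ∀ m → + m / 2 ≡ ½ * ι m
half-ι m = toℚᵘ-injective (ℚᵘ.≃-trans (toℚᵘ-fromℚᵘ (mkℚᵘ (+ m) 1)) (ℚᵘ.≃-trans (*≡* (identity (+ m)))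
  (ℚᵘ.≃-sym (ℚᵘ.≃-trans (toℚᵘ-homo-* ½ (ι m)) (ℚᵘ.*-cong (ℚᵘ.≃-refl {toℚᵘ ½}) (toℚᵘ-ι m))))))
  where
  identity : ∀ a → a ℤ.* (+ 2 ℤ.* + 1) ≡ (+ 1 ℤ.* a) ℤ.* + 2
  identity = ℤ-Solver.solve-∀

ι-mono : ∀ {a b} → a ℕ.≤ b → ι a ≤ ι b
ι-mono {a} {b} a≤b = toℚᵘ-cancel-≤ (ℚᵘ.≤-trans (ℚᵘ.≤-reflexive (toℚᵘ-ι a))
  (ℚᵘ.≤-trans (*≤* (ℤ.*-monoʳ-≤-nonNeg (+ 1) (ℤ.+≤+ a≤b))) (ℚᵘ.≤-reflexive (ℚᵘ.≃-sym (toℚᵘ-ι b)))))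

0≤ι : ∀ a → 0ℚ ≤ ι a
0≤ι a = subst (_≤ ι a) ι-0 (ι-mono z≤n)

ι-suc : ∀ a → ι (suc a) ≡ 1ℚ + ι a
ι-suc a = trans (ι-+ 1 a) (cong (_+ ι a) ι-1)

archimedean : ∀ {ε} → 0ℚ < ε → ∃ λ D → 1ℚ ≤ ι D * ε
archimedean {mkℚ (+ zero)    d _} (*<* (ℤ.+<+ ()))
archimedean {ε@(mkℚ (+ suc a) d _)} _ = suc d , toℚᵘ-cancel-≤ (ℚᵘ.≤-trans
  (*≤* (subst₂ ℤ._≤_ (sym (ℤ.pos-* 1 (1 ℕ.* suc d))) (ℤ.pos-* (suc d ℕ.* suc a) 1)
    (ℤ.+≤+ (ℕ.≤-trans (ℕ.≤-reflexive (trans (ℕ.*-identityˡ (1 ℕ.* suc d)) (ℕ.*-identityˡ (suc d)))) (ℕ.≤-trans (ℕ.m≤m*n (suc d) (suc a)) (ℕ.≤-reflexive (sym (ℕ.*-identityʳ (suc d ℕ.* suc a)))))))))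
  (ℚᵘ.≤-reflexive (ℚᵘ.≃-sym (ℚᵘ.≃-trans (toℚᵘ-homo-* (ι (suc d)) ε) (ℚᵘ.*-cong (toℚᵘ-ι (suc d)) (ℚᵘ.≃-refl {toℚᵘ ε}))))))

*-mono-≤ : ∀ {p q r s} → 0ℚ ≤ p → 0ℚ ≤ s → p ≤ q → r ≤ s → p * r ≤ q * s
*-mono-≤ {p} {q} {r} {s} 0≤p 0≤s p≤q r≤s =
  ≤-trans (*-monoˡ-≤-nonNeg p {{nonNegative 0≤p}} r≤s) (*-monoʳ-≤-nonNeg s {{nonNegative 0≤s}} p≤q)

partialE-survival : ∀ {n} (π : Policy n) M → partialE π M ≡ sumℚ (applyUpTo (λ m → survival π m (zero ∷ [])) M)
partialE-survival π M = cong sumℚ (trans (map-cong (tailProb-survival π) (upTo M)) (map-upTo (λ m → survival π m (zero ∷ [])) M))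

sum-cong : ∀ {f g : ℕ → ℚ} → (∀ m → f m ≡ g m) → ∀ M → sumℚ (applyUpTo f M) ≡ sumℚ (applyUpTo g M)
sum-cong eq zero    = refl
sum-cong eq (suc M) = cong₂ _+_ (eq 0) (sum-cong (eq ∘ suc) M)

-- Here f m will be P(T_C > m), and e m an expected remaining quantity after m steps: e 0 is the
-- candidate for the expectation and e M the error of the partial sum.
telescope : ∀ (f e : ℕ → ℚ) → (∀ m → e m ≡ f m + e (suc m)) → ∀ M → sumℚ (applyUpTo f M) + e M ≡ e 0
telescope f e eq zero    = +-identityˡ (e 0)
telescope f e eq (suc M) = begin
  f 0 + sumℚ (applyUpTo (f ∘ suc) M) + e (suc M)     ≡⟨ +-assoc (f 0) _ (e (suc M)) ⟩
  f 0 + (sumℚ (applyUpTo (f ∘ suc) M) + e (suc M))   ≡⟨ cong (λ t → f 0 + t) (telescope (f ∘ suc) (e ∘ suc) (eq ∘ suc) M) ⟩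
  f 0 + e 1                                         ≡⟨ eq 0 ⟨
  e 0                                               ∎
  where open ≡-Reasoning

antitone-sum : ∀ (f : ℕ → ℚ) → (∀ m → f (suc m) ≤ f m) → ∀ M → ι M * f M ≤ sumℚ (applyUpTo f M)
antitone-sum f anti zero    = ≤-reflexive (trans (cong (_* f 0) ι-0) (*-zeroˡ (f 0)))
antitone-sum f anti (suc M) = begin
  ι (suc M) * f (suc M)               ≡⟨ cong (_* f (suc M)) (ι-suc M) ⟩
  (1ℚ + ι M) * f (suc M)              ≡⟨ distrib (ι M) (f (suc M)) ⟩
  f (suc M) + ι M * f (suc M)         ≤⟨ +-mono-≤ (below-first (suc M)) (antitone-sum (f ∘ suc) (anti ∘ suc) M) ⟩
  f 0 + sumℚ (applyUpTo (f ∘ suc) M)  ∎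
  where
  open ≤-Reasoning
  distrib : ∀ k x → (1ℚ + k) * x ≡ x + k * x
  distrib = solve-∀ ℚ-ring
  below-first : ∀ m → f m ≤ f 0
  below-first zero    = ≤-refl
  below-first (suc m) = ≤-trans (anti m) (below-first m)

-- Choose D with D ε ≥ 1. For M > K D, an error of at least ε would give M e M ≥ (1 + K D) ε ≥ K + ε
-- > K.
converges-from-error : ∀ (s e : ℕ → ℚ) {L} K → (∀ M → s M + e M ≡ L) → (∀ M → 0ℚ ≤ e M) →
  (∀ M → ι M * e M ≤ ι K) → ConvergesTo s L
converges-from-error s e {L} K s+e≡L 0≤e Me≤K ε 0<ε with archimedean 0<ε
... | D , 1≤Dε = suc (K ℕ.* D) , λ M M₀≤M → ≰⇒> (λ ε≤∣s-L∣ → <-irrefl refl (begin-strict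
    ι K                          ≡⟨ trans (+-identityʳ (ι K * 1ℚ)) (*-identityʳ (ι K)) ⟨
    ι K * 1ℚ + 0ℚ                <⟨ +-mono-≤-< (*-monoˡ-≤-nonNeg (ι K) {{nonNegative (0≤ι K)}} 1≤Dε) 0<ε ⟩
    ι K * (ι D * ε) + ε          ≡⟨ collect (ι K) (ι D) ε ⟨
    (1ℚ + ι K * ι D) * ε         ≡⟨ cong (_* ε) (trans (ι-suc (K ℕ.* D)) (cong (λ t → 1ℚ + t) (ι-* K D))) ⟨
    ι (suc (K ℕ.* D)) * ε        ≤⟨ *-mono-≤ (0≤ι (suc (K ℕ.* D))) (0≤e M) (ι-mono M₀≤M) (≤-trans ε≤∣s-L∣ (≤-reflexive (distance M))) ⟩
    ι M * e M                    ≤⟨ Me≤K M ⟩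
    ι K                          ∎))
  where
  open ≤-Reasoning
  collect : ∀ k d x → (1ℚ + k * d) * x ≡ k * (d * x) + x
  collect = solve-∀ ℚ-ring
  gap : ∀ a b → a - (a + b) ≡ - b
  gap = solve-∀ ℚ-ring
  distance : ∀ M → ∣ s M - L ∣ ≡ e M
  distance M = trans (cong ∣_∣ (trans (cong (λ t → s M - t) (sym (s+e≡L M))) (gap (s M) (e M))))
    (trans (∣-p∣≡∣p∣ (e M)) (0≤p⇒∣p∣≡p (0≤e M)))

-- `survival` runs on after covering, but an extension of a covering history still covers, so every
-- final value is 0.
survival-covered : ∀ {n} (π : Policy n) m h → covers h ≡ true → survival π m h ≡ 0ℚ
survival-covered π zero    h eq rewrite eq = refl
survival-covered π (suc m) h eq = zeros (π h)
  where
  zeros : ∀ js → sumℚ (List.map (λ j → uniformWeight (π h) * survival π m (j ∷ h)) js) ≡ 0ℚ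
  zeros []       = refl
  zeros (j ∷ js) = trans (cong₂ _+_ (trans (cong (uniformWeight (π h) *_) vanish) (*-zeroʳ (uniformWeight (π h)))) (zeros js)) (+-identityˡ 0ℚ)
    where
    vanish : survival π m (j ∷ h) ≡ 0ℚ
    vanish = survival-covered π m (j ∷ h) (covers-true {h = j ∷ h} (λ v → there (covers-sound {h = h} eq v)))

-- Negative feedback: from histories to leans

module _ {n} {x y : Node n} {h : History n} where

  Ncount-elsewhere : ∀ {v} w → v ≢ x → Ncount (y ∷ x ∷ h) v w ≡ Ncount (x ∷ h) v w
  Ncount-elsewhere {v} w v≢x with x Fin.≟ v
  ... | yes x≡v = contradiction (sym x≡v) v≢x
  ... | no  _   = refl

  Ncount-taken : Ncount (y ∷ x ∷ h) x y ≡ suc (Ncount (x ∷ h) x y)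
  Ncount-taken with x Fin.≟ x | y Fin.≟ y
  ... | yes _  | yes _  = refl
  ... | no x≢x | _      = contradiction refl x≢x
  ... | yes _  | no y≢y = contradiction refl y≢y

  Ncount-untaken : ∀ {w} → y ≢ w → Ncount (y ∷ x ∷ h) x w ≡ Ncount (x ∷ h) x w
  Ncount-untaken {w} y≢w with x Fin.≟ x | y Fin.≟ w
  ... | _     | yes y≡w = contradiction y≡w y≢w
  ... | yes _ | no _    = refl
  ... | no _  | no _    = refl

Ncount-unvisited : ∀ {n} (h : History n) {v} w → v ∉ h → Ncount h v w ≡ 0
Ncount-unvisited []          w v∉h = refl
Ncount-unvisited (_ ∷ [])    w v∉h = refl
Ncount-unvisited (y ∷ x ∷ h) w v∉h = trans
  (Ncount-elsewhere {h = h} w (v∉h ∘ there ∘ here)) (Ncount-unvisited (x ∷ h) w (v∉h ∘ there))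

-- The difference between the numbers of g-exits and g'-exits from a node: 0, +1 or −1.
data Lean : Set where
  balanced forward backward : Lean

opposite : Lean → Lean
opposite balanced = balanced
opposite forward  = backward
opposite backward = forward

Leaning : ∀ {n} (g g' : Node n → Node n) → History n → Node n → Lean → Set
Leaning g g' h x balanced = Ncount h x (g x) ≡ Ncount h x (g' x)
Leaning g g' h x forward  = Ncount h x (g x) ≡ suc (Ncount h x (g' x))
Leaning g g' h x backward = Ncount h x (g' x) ≡ suc (Ncount h x (g x))

-- The last exit from a node on the g'-side of the walker went in direction g,
-- so the difference there is 0 or +1, and one bit describes it.
trail : Bool → Lean
trail true  = forward
trail false = balanced

Trail : ∀ {n} (g g' : Node n → Node n) → History n → Node n → ∀ {l} → Vec Bool l → Set
Trail g g' h v []       = ⊤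
Trail g g' h v (b ∷ bs) = Leaning g g' h v (trail b) × Trail g g' h (g' v) bs

-- Both trails are read outwards from the walker, the right one with g and g' exchanged, so a bit
-- always records a lean towards the walker.
record Configuration {n} (g g' : Node n → Node n) (h : History n) (x : Node n)
                     {l r} (ls : Vec Bool l) (c : Lean) (rs : Vec Bool r) : Set where
  field
    arc    : Arc g g' h x l r
    centre : Leaning g g' h x c
    left   : Trail g g' h (g' x) ls
    right  : Trail g' g h (g x) rs

open Configuration

-- Exit c a: a node with lean c can be left in direction g, and then has lean trail a.
data Exit : Lean → Bool → Set where
  from-balanced : Exit balanced true
  from-backward : Exit backward false

module _ {n} {g g' : Node n → Node n} where

  leaning-flip : ∀ {h : History n} {x} c → Leaning g g' h x c → Leaning g' g h x (opposite c)
  leaning-flip balanced = sym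
  leaning-flip forward  eq = eq
  leaning-flip backward eq = eq

  leaning-elsewhere : ∀ {h : History n} {x y v} c → v ≢ x →
    Leaning g g' (x ∷ h) v c → Leaning g g' (y ∷ x ∷ h) v c
  leaning-elsewhere {h} {v = v} balanced v≢x eq =
    trans (Ncount-elsewhere {h = h} (g v) v≢x) (trans eq (sym (Ncount-elsewhere {h = h} (g' v) v≢x)))
  leaning-elsewhere {h} {v = v} forward  v≢x eq =
    trans (Ncount-elsewhere {h = h} (g v) v≢x) (trans eq (cong suc (sym (Ncount-elsewhere {h = h} (g' v) v≢x))))
  leaning-elsewhere {h} {v = v} backward v≢x eq =
    trans (Ncount-elsewhere {h = h} (g' v) v≢x) (trans eq (cong suc (sym (Ncount-elsewhere {h = h} (g v) v≢x))))

  trail-elsewhere : ∀ {h : History n} {x y v l} (bs : Vec Bool l) → (∀ i → i ℕ.< l → fold v g' i ≢ x) →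
    Trail g g' (x ∷ h) v bs → Trail g g' (y ∷ x ∷ h) v bs
  trail-elsewhere         []       _  _        = tt
  trail-elsewhere {v = v} (b ∷ bs) ≢x (t , ts) = leaning-elsewhere (trail b) (≢x 0 (s≤s z≤n)) t ,
    trail-elsewhere bs (λ i i<l → subst (_≢ _) (sym (fold-shift g' v i)) (≢x (suc i) (s≤s i<l))) ts

  leaning-exit : ∀ {h : History n} {x c a} → g x ≢ g' x → Exit c a →
    Leaning g g' (x ∷ h) x c → Leaning g g' (g x ∷ x ∷ h) x (trail a)
  leaning-exit {h} {x} g≢g' from-balanced eq =
    trans (Ncount-taken {h = h}) (cong suc (trans eq (sym (Ncount-untaken {h = h} g≢g'))))
  leaning-exit {h} {x} g≢g' from-backward eq =
    trans (Ncount-taken {h = h}) (trans (sym eq) (sym (Ncount-untaken {h = h} g≢g')))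

configuration-flip : ∀ {n} {g g' : Node n → Node n} {h x l r c} {ls : Vec Bool l} {rs : Vec Bool r} →
  Configuration g g' h x ls c rs → Configuration g' g h x rs (opposite c) ls
configuration-flip C .arc    = mirror (arc C)
configuration-flip {c = c} C .centre = leaning-flip c (centre C)
configuration-flip C .left   = right C
configuration-flip C .right  = left C

module _ {n} {g g' : Node n → Node n} (ρ : Rotation g g') (1<n : 1 ℕ.< n) where
  open Rotation

  -- The node just left becomes the nearest one on the trail behind. The l further nodes differ from
  -- it because l ≤ n, hence their counts are unchanged.
  leave-trail : ∀ {h x l c a} {ls : Vec Bool l} → Exit c a → l ℕ.≤ n →
    Leaning g g' (x ∷ h) x c → Trail g g' (x ∷ h) (g' x) ls →
    Trail g g' (g x ∷ x ∷ h) (g' (g x)) (a ∷ ls)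
  leave-trail {h} {x} {a = a} {ls} e l≤n lean t = subst (λ v → Trail g g' (g x ∷ x ∷ h) v (a ∷ ls)) (sym (inverseˡ ρ x))
    (leaning-exit (g≢g' ρ 1<n x) e lean ,
     trail-elsewhere ls (λ i i<l → subst (_≢ x) (sym (fold-shift g' x i)) (aperiodic (reverse ρ) x i (ℕ.<-≤-trans i<l l≤n))) t)

  -- The node ahead leans towards the walker, that is, against the direction of travel; this
  -- explains `opposite`.
  proceed : ∀ {h x l r c a b} {ls : Vec Bool l} {rs : Vec Bool r} → Exit c a → l ℕ.+ suc r ℕ.≤ n →
    Configuration g g' (x ∷ h) x ls c (b ∷ rs) →
    Configuration g g' (g x ∷ x ∷ h) (g x) (a ∷ ls) (opposite (trail b)) rs
  proceed e l+r≤n C .arc = advance ρ (arc C)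
  proceed {x = x} {b = b} e l+r≤n C .centre =
    leaning-elsewhere (opposite (trail b)) (g≢id ρ (ℕ.<-trans (s≤s z≤n) 1<n) x) (leaning-flip (trail b) (proj₁ (right C)))
  proceed {l = l} e l+r≤n C .left = leave-trail e (ℕ.≤-trans (ℕ.m≤m+n l _) l+r≤n) (centre C) (left C)
  proceed {x = x} {l = l} {rs = rs} e l+r≤n C .right = trail-elsewhere rs
    (λ i i<r → subst (_≢ x) (sym (trans (fold-shift g (g x) i) (cong g (fold-shift g x i))))
       (aperiodic ρ x (suc i) (ℕ.<-≤-trans (s≤s i<r) (ℕ.≤-trans (ℕ.m≤n+m _ l) l+r≤n))))
    (proj₂ (right C))

  discover : ∀ {h x l c a} {ls : Vec Bool l} → Exit c a → l ℕ.+ 0 ℕ.< n →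
    Configuration g g' (x ∷ h) x ls c [] →
    Configuration g g' (g x ∷ x ∷ h) (g x) (a ∷ ls) balanced []
  discover e l<n C .arc = advance ρ (arc C)
  discover {h} {x} e l<n C .centre = leaning-elsewhere {g = g} {g' = g'} {h = h} balanced (g≢id ρ (ℕ.<-trans (s≤s z≤n) 1<n) x)
    (trans (Ncount-unvisited (x ∷ h) (g (g x)) new) (sym (Ncount-unvisited (x ∷ h) (g' (g x)) new)))
    where
    new : g x ∉ x ∷ h
    new = beyond-arc ρ (arc C) l<n
  discover {l = l} e l<n C .left = leave-trail e (ℕ.≤-trans (ℕ.m≤m+n l 0) (ℕ.<⇒≤ l<n)) (centre C) (left C)
  discover e l<n C .right = tt

-- The bits describe the trails on the two sides of the walker, nearest node first.
data State : Set where
  ⟨_,_,_⟩ : ∀ {l r} → Vec Bool l → Lean → Vec Bool r → State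

-- The first argument is the number of unvisited nodes.
Observable : Set
Observable = ℕ → State → ℚ

module _ (F : Observable) (d : ℕ) where

  goForward : ∀ {l r} → Vec Bool l → Vec Bool r → ℚ
  goForward ls []       = F d ⟨ ls , balanced , [] ⟩
  goForward ls (b ∷ rs) = F (suc d) ⟨ ls , opposite (trail b) , rs ⟩

  goBackward : ∀ {l r} → Vec Bool l → Vec Bool r → ℚ
  goBackward []       rs = F d ⟨ [] , balanced , rs ⟩
  goBackward (b ∷ ls) rs = F (suc d) ⟨ ls , trail b , rs ⟩

  next : State → ℚ
  next ⟨ ls , balanced , rs ⟩ = ½ * goForward (true ∷ ls) rs + ½ * goBackward ls (true ∷ rs)
  next ⟨ ls , forward  , rs ⟩ = goBackward ls (false ∷ rs)
  next ⟨ ls , backward , rs ⟩ = goForward (false ∷ ls) rs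

negSurvival : ℕ → Observable
negSurvival m       zero    σ = 0ℚ
negSurvival zero    (suc d) σ = 1ℚ
negSurvival (suc m) (suc d) σ = next (negSurvival m) d σ

≤ᵇ-true : ∀ {a b} → a ℕ.≤ b → (a ≤ᵇ b) ≡ true
≤ᵇ-true a≤b = Equivalence.to T-≡ (ℕ.≤⇒≤ᵇ a≤b)

≤ᵇ-refl : ∀ a → (a ≤ᵇ a) ≡ true
≤ᵇ-refl a = ≤ᵇ-true (ℕ.≤-refl {a})

≤ᵇ-false : ∀ {a b} → b ℕ.< a → (a ≤ᵇ b) ≡ false
≤ᵇ-false {a} {b} b<a = ¬-not (λ eq → ℕ.<⇒≱ b<a (ℕ.≤ᵇ⇒≤ a b (Equivalence.from T-≡ eq)))

candidates : ∀ {n} → Lean → Node n → List (Node n)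
candidates balanced x = predC x ∷ succC x ∷ []
candidates forward  x = predC x ∷ []
candidates backward x = succC x ∷ []

filterᵇ-pair : ∀ {A : Set} (p : A → Bool) a b {α β} → p a ≡ α → p b ≡ β →
  List.filterᵇ p (a ∷ b ∷ []) ≡ (if α then a ∷_ else id) ((if β then b ∷_ else id) [])
filterᵇ-pair p _ _ {α = true}  {true}  pa pb rewrite pa | pb = refl
filterᵇ-pair p _ _ {α = true}  {false} pa pb rewrite pa | pb = refl
filterᵇ-pair p _ _ {α = false} {true}  pa pb rewrite pa | pb = refl
filterᵇ-pair p _ _ {α = false} {false} pa pb rewrite pa | pb = refl

minimal : ∀ {n} → History n → Node n → Node n → Bool
minimal h x j = all (λ k → Ncount h x j ≤ᵇ Ncount h x k) (nbrs x)

Smin-leaning : ∀ {n} {h : History n} {x} c → Leaning succC predC h x c → Smin h x ≡ candidates c x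
Smin-leaning {h = h} {x} balanced eq = filterᵇ-pair (minimal h x) (predC x) (succC x)
  (cong₂ _∧_ (≤ᵇ-refl (Ncount h x (predC x))) (cong (_∧ true) (≤ᵇ-true (ℕ.≤-reflexive (sym eq)))))
  (cong₂ _∧_ (≤ᵇ-true (ℕ.≤-reflexive eq)) (cong (_∧ true) (≤ᵇ-refl (Ncount h x (succC x)))))
Smin-leaning {h = h} {x} forward eq = filterᵇ-pair (minimal h x) (predC x) (succC x)
  (cong₂ _∧_ (≤ᵇ-refl (Ncount h x (predC x))) (cong (_∧ true) (≤ᵇ-true (ℕ.≤-trans (ℕ.n≤1+n (Ncount h x (predC x))) (ℕ.≤-reflexive (sym eq))))))
  (cong (_∧ ((Ncount h x (succC x) ≤ᵇ Ncount h x (succC x)) ∧ true)) (≤ᵇ-false (ℕ.≤-reflexive (sym eq))))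
Smin-leaning {h = h} {x} backward eq = filterᵇ-pair (minimal h x) (predC x) (succC x)
  (cong₂ _∧_ (≤ᵇ-refl (Ncount h x (predC x))) (cong (_∧ true) (≤ᵇ-false (ℕ.≤-reflexive (sym eq)))))
  (cong₂ _∧_ (≤ᵇ-true (ℕ.≤-trans (ℕ.n≤1+n (Ncount h x (succC x))) (ℕ.≤-reflexive (sym eq)))) (cong (_∧ true) (≤ᵇ-refl (Ncount h x (succC x)))))

incomplete : ∀ {k d n} → k ℕ.+ suc d ≡ n → k ℕ.< n
incomplete {k} {d} eq = subst (k ℕ.<_) eq (ℕ.m<m+n k (s≤s z≤n))

module _ {n} (1<n : 1 ℕ.< n) where

  private
    Simulates : ℕ → Set
    Simulates m = ∀ d {x h l r c} {ls : Vec Bool l} {rs : Vec Bool r} → l ℕ.+ r ℕ.+ d ≡ n →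
      Configuration {n} succC predC (x ∷ h) x ls c rs →
      survival πneg m (x ∷ h) ≡ negSurvival m d ⟨ ls , c , rs ⟩

    simulate-forward : ∀ {m} → Simulates m → ∀ d {x h l r c a} {ls : Vec Bool l} {rs : Vec Bool r} →
      l ℕ.+ r ℕ.+ suc d ≡ n → Exit c a → Configuration {n} succC predC (x ∷ h) x ls c rs →
      survival πneg m (succC x ∷ x ∷ h) ≡ goForward (negSurvival m) d (a ∷ ls) rs
    simulate-forward ih d {l = l} {rs = []}     eq e C =
      ih d (trans (sym (ℕ.+-suc (l ℕ.+ 0) d)) eq) (discover rotation-succ 1<n e (incomplete eq) C)
    simulate-forward ih d {l = l} {suc r} {rs = b ∷ rs} eq e C =
      ih (suc d) (trans (cong (ℕ._+ suc d) (sym (ℕ.+-suc l r))) eq) (proceed rotation-succ 1<n e (ℕ.<⇒≤ (incomplete eq)) C)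

    simulate-backward : ∀ {m} → Simulates m → ∀ d {x h l r c a} {ls : Vec Bool l} {rs : Vec Bool r} →
      l ℕ.+ r ℕ.+ suc d ≡ n → Exit (opposite c) a → Configuration {n} succC predC (x ∷ h) x ls c rs →
      survival πneg m (predC x ∷ x ∷ h) ≡ goBackward (negSurvival m) d ls (a ∷ rs)
    simulate-backward ih d {r = r} {ls = []}     eq e C =
      ih d (trans (sym (ℕ.+-suc r d)) eq)
        (configuration-flip (discover (reverse rotation-succ) 1<n e
          (subst (ℕ._< n) (sym (ℕ.+-identityʳ r)) (incomplete eq)) (configuration-flip C)))
    simulate-backward ih d {l = suc l} {r} {ls = b ∷ ls} eq e C =
      ih (suc d) (trans (cong (ℕ._+ suc d) (ℕ.+-suc l r)) eq)
        -- Passing to the mirrored cycle and back reverses the lean of the entered node twice.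
        (subst (λ c → Configuration succC predC _ _ ls c _) (opposite-involutive (trail b))
          (configuration-flip (proceed (reverse rotation-succ) 1<n e
            (ℕ.≤-trans (ℕ.≤-reflexive (ℕ.+-comm r (suc l))) (ℕ.<⇒≤ (incomplete eq))) (configuration-flip C))))
      where
      opposite-involutive : ∀ c → opposite (opposite c) ≡ c
      opposite-involutive balanced = refl
      opposite-involutive forward  = refl
      opposite-involutive backward = refl

  -- The candidates depend only on the lean of the walker's node, and each move leads to a
  -- configuration determined by the state, so the process on histories projects to one on states.
  survival-neg : ∀ m → Simulates m
  survival-neg zero    zero    {x} {h} {l} {r} eq C = survival-covered {n} πneg 0 (x ∷ h) (covers-full rotation-succ (arc C) (trans (sym (ℕ.+-identityʳ (l ℕ.+ r))) eq))
  survival-neg (suc m) zero    {x} {h} {l} {r} eq C = survival-covered {n} πneg (suc m) (x ∷ h) (covers-full rotation-succ (arc C) (trans (sym (ℕ.+-identityʳ (l ℕ.+ r))) eq))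
  survival-neg zero    (suc d) eq C rewrite covers-partial rotation-succ (arc C) (incomplete eq) = refl
  survival-neg (suc m) (suc d) {x} {h} {c = c} eq C =
    trans (cong (λ js → sumℚ (List.map (λ j → uniformWeight js * survival πneg m (j ∷ x ∷ h)) js)) (Smin-leaning c (centre C)))
          (moves c eq C)
    where
    arrange : ∀ b f → ½ * b + (½ * f + 0ℚ) ≡ ½ * f + ½ * b
    arrange = solve-∀ ℚ-ring
    single : ∀ s → 1ℚ * s + 0ℚ ≡ s
    single = solve-∀ ℚ-ring
    survive : Node n → ℚ
    survive j = survival πneg m (j ∷ x ∷ h)
    moves : ∀ c {l r} {ls : Vec Bool l} {rs : Vec Bool r} → l ℕ.+ r ℕ.+ suc d ≡ n →
      Configuration {n} succC predC (x ∷ h) x ls c rs →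
      sumℚ (List.map (λ j → uniformWeight (candidates c x) * survive j) (candidates c x))
        ≡ next (negSurvival m) d ⟨ ls , c , rs ⟩
    moves balanced eq C = trans (arrange (survive (predC x)) (survive (succC x))) (cong₂ (λ f b → ½ * f + ½ * b)
      (simulate-forward (survival-neg m) d eq from-balanced C) (simulate-backward (survival-neg m) d eq from-balanced C))
    moves forward  eq C = trans (single (survive (predC x))) (simulate-backward (survival-neg m) d eq from-backward C)
    moves backward eq C = trans (single (survive (succC x))) (simulate-forward (survival-neg m) d eq from-backward C)

-- Random walk: gambler's ruin

-- For the random walk, a state consists of the number d of unvisited nodes and
-- the numbers l and r of visited nodes on the two sides of the walker.
module _ (F : ℕ → ℕ → ℕ → ℚ) (d : ℕ) where

  walkForward : ℕ → ℕ → ℚ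
  walkForward l zero    = F d (suc l) 0
  walkForward l (suc r) = F (suc d) (suc l) r

  walkBackward : ℕ → ℕ → ℚ
  walkBackward zero    r = F d 0 (suc r)
  walkBackward (suc l) r = F (suc d) l (suc r)

  walk : ℕ → ℕ → ℚ
  walk l r = ½ * walkForward l r + ½ * walkBackward l r

-- P^m F, where P is the transition operator of the walk killed on covering.
evolve : (ℕ → ℕ → ℕ → ℚ) → ℕ → ℕ → ℕ → ℕ → ℚ
evolve F zero    d       l r = F d l r
evolve F (suc m) zero    l r = 0ℚ
evolve F (suc m) (suc d) l r = walk (evolve F m) d l r

alive : ℕ → ℕ → ℕ → ℚ
alive zero    l r = 0ℚ
alive (suc d) l r = 1ℚ

survival-rw : ∀ {n} m d {x h l r} → l ℕ.+ r ℕ.+ d ≡ n → Arc {n} succC predC (x ∷ h) x l r →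
  survival πrw m (x ∷ h) ≡ evolve alive m d l r
survival-rw zero    zero    {x} {h} {l} {r} eq A = survival-covered πrw 0 (x ∷ h) (covers-full rotation-succ A (trans (sym (ℕ.+-identityʳ (l ℕ.+ r))) eq))
survival-rw (suc m) zero    {x} {h} {l} {r} eq A = survival-covered πrw (suc m) (x ∷ h) (covers-full rotation-succ A (trans (sym (ℕ.+-identityʳ (l ℕ.+ r))) eq))
survival-rw zero    (suc d) eq A rewrite covers-partial rotation-succ A (incomplete eq) = refl
survival-rw (suc m) (suc d) {x} {h} {l} {r} eq A =
  trans (arrange (survival πrw m (predC x ∷ x ∷ h)) (survival πrw m (succC x ∷ x ∷ h)))
    (cong₂ (λ f b → ½ * f + ½ * b) (forwards l r eq A) (backwards l r eq A))
  where
  arrange : ∀ b f → ½ * b + (½ * f + 0ℚ) ≡ ½ * f + ½ * b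
  arrange = solve-∀ ℚ-ring
  forwards : ∀ l r → l ℕ.+ r ℕ.+ suc d ≡ _ → Arc succC predC (x ∷ h) x l r →
    survival πrw m (succC x ∷ x ∷ h) ≡ walkForward (evolve alive m) d l r
  forwards l zero    eq A = survival-rw m d (trans (sym (ℕ.+-suc (l ℕ.+ 0) d)) eq) (advance rotation-succ A)
  forwards l (suc r) eq A = survival-rw m (suc d) (trans (cong (ℕ._+ suc d) (sym (ℕ.+-suc l r))) eq) (advance rotation-succ A)
  backwards : ∀ l r → l ℕ.+ r ℕ.+ suc d ≡ _ → Arc succC predC (x ∷ h) x l r →
    survival πrw m (predC x ∷ x ∷ h) ≡ walkBackward (evolve alive m) d l r
  backwards zero    r eq A = survival-rw m d (trans (sym (ℕ.+-suc r d)) eq)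
    (mirror (advance (reverse rotation-succ) (mirror A)))
  backwards (suc l) r eq A = survival-rw m (suc d) (trans (cong (ℕ._+ suc d) (ℕ.+-suc l r)) eq)
    (mirror (advance (reverse rotation-succ) (mirror A)))

-- P^m is linear: it is applied to V = `alive` + P V. The result is the telescoping hypothesis.
evolve-additive : ∀ {F} → (∀ d l r → F d l r ≡ alive d l r + evolve F 1 d l r) →
  ∀ m d l r → evolve F m d l r ≡ evolve alive m d l r + evolve F (suc m) d l r
evolve-additive     eq zero    d       l r = eq d l r
evolve-additive     eq (suc m) zero    l r = refl
evolve-additive {F} eq (suc m) (suc d) l r = trans
  (cong₂ (λ f b → ½ * f + ½ * b) (forwards l r) (backwards l r))
  (interchange (walkForward (evolve alive m) d l r) (walkForward (evolve F (suc m)) d l r)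
               (walkBackward (evolve alive m) d l r) (walkBackward (evolve F (suc m)) d l r))
  where
  interchange : ∀ a b c d → ½ * (a + b) + ½ * (c + d) ≡ (½ * a + ½ * c) + (½ * b + ½ * d)
  interchange = solve-∀ ℚ-ring
  forwards : ∀ l r → walkForward (evolve F m) d l r ≡ walkForward (evolve alive m) d l r + walkForward (evolve F (suc m)) d l r
  forwards l zero    = evolve-additive eq m d (suc l) 0
  forwards l (suc r) = evolve-additive eq m (suc d) (suc l) r
  backwards : ∀ l r → walkBackward (evolve F m) d l r ≡ walkBackward (evolve alive m) d l r + walkBackward (evolve F (suc m)) d l r
  backwards zero    r = evolve-additive eq m d 0 (suc r)
  backwards (suc l) r = evolve-additive eq m (suc d) l (suc r)

evolve-nonNegative : ∀ {F} → (∀ d l r → 0ℚ ≤ F d l r) → ∀ m d l r → 0ℚ ≤ evolve F m d l r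
evolve-nonNegative     0≤F zero    d       l r = 0≤F d l r
evolve-nonNegative     0≤F (suc m) zero    l r = ≤-refl
evolve-nonNegative {F} 0≤F (suc m) (suc d) l r =
  +-mono-≤ (*-monoˡ-≤-nonNeg ½ (forwards l r)) (*-monoˡ-≤-nonNeg ½ (backwards l r))
  where
  forwards : ∀ l r → 0ℚ ≤ walkForward (evolve F m) d l r
  forwards l zero    = evolve-nonNegative 0≤F m d (suc l) 0
  forwards l (suc r) = evolve-nonNegative 0≤F m (suc d) (suc l) r
  backwards : ∀ l r → 0ℚ ≤ walkBackward (evolve F m) d l r
  backwards zero    r = evolve-nonNegative 0≤F m d 0 (suc r)
  backwards (suc l) r = evolve-nonNegative 0≤F m (suc d) l (suc r)

module _ {n : ℕ} where

  walk-mono : ∀ {F G : ℕ → ℕ → ℕ → ℚ} → (∀ d l r → l ℕ.+ r ℕ.+ d ≡ n → F d l r ≤ G d l r) →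
    ∀ d l r → l ℕ.+ r ℕ.+ suc d ≡ n → walk F d l r ≤ walk G d l r
  walk-mono {F} {G} F≤G d l r eq =
    +-mono-≤ (*-monoˡ-≤-nonNeg ½ (forwards l r eq)) (*-monoˡ-≤-nonNeg ½ (backwards l r eq))
    where
    forwards : ∀ l r → l ℕ.+ r ℕ.+ suc d ≡ n → walkForward F d l r ≤ walkForward G d l r
    forwards l zero    eq = F≤G d (suc l) 0 (trans (sym (ℕ.+-suc (l ℕ.+ 0) d)) eq)
    forwards l (suc r) eq = F≤G (suc d) (suc l) r (trans (cong (ℕ._+ suc d) (sym (ℕ.+-suc l r))) eq)
    backwards : ∀ l r → l ℕ.+ r ℕ.+ suc d ≡ n → walkBackward F d l r ≤ walkBackward G d l r
    backwards zero    r eq = F≤G d 0 (suc r) (trans (sym (ℕ.+-suc r d)) eq)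
    backwards (suc l) r eq = F≤G (suc d) l (suc r) (trans (cong (ℕ._+ suc d) (ℕ.+-suc l r)) eq)

  -- P preserves inequalities, so V ≤ C `alive` turns into the bound C P(T_C > m) on the error. The
  -- constraint l + r + d = n is carried along because V is bounded only for fixed n.
  evolve-bounded : ∀ {F} C → (∀ d l r → l ℕ.+ r ℕ.+ d ≡ n → F d l r ≤ C * alive d l r) →
    ∀ m d l r → l ℕ.+ r ℕ.+ d ≡ n → evolve F m d l r ≤ C * evolve alive m d l r
  evolve-bounded     C F≤ zero    d       l r eq = F≤ d l r eq
  evolve-bounded     C F≤ (suc m) zero    l r eq = ≤-reflexive (sym (*-zeroʳ C))
  evolve-bounded {F} C F≤ (suc m) (suc d) l r eq = ≤-trans
    (walk-mono {G = λ d l r → C * evolve alive m d l r} (evolve-bounded C F≤ m) d l r eq)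
    (≤-reflexive (trans (cong₂ (λ f b → ½ * f + ½ * b) (forwards l r) (backwards l r))
      (factor C (walkForward (evolve alive m) d l r) (walkBackward (evolve alive m) d l r))))
    where
    factor : ∀ c a b → ½ * (c * a) + ½ * (c * b) ≡ c * (½ * a + ½ * b)
    factor = solve-∀ ℚ-ring
    forwards : ∀ l r → walkForward (λ d l r → C * evolve alive m d l r) d l r ≡ C * walkForward (evolve alive m) d l r
    forwards l zero    = refl
    forwards l (suc r) = refl
    backwards : ∀ l r → walkBackward (λ d l r → C * evolve alive m d l r) d l r ≡ C * walkBackward (evolve alive m) d l r
    backwards zero    r = refl
    backwards (suc l) r = refl

  alive-antitone : ∀ m d l r → l ℕ.+ r ℕ.+ d ≡ n → evolve alive (suc m) d l r ≤ evolve alive m d l r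
  alive-antitone zero    zero    l r eq = ≤-refl
  alive-antitone (suc m) zero    l r eq = ≤-refl
  alive-antitone zero    (suc d) l r eq = ≤-trans (walk-mono {G = λ _ _ _ → 1ℚ} alive≤1 d l r eq) (≤-reflexive (certain l r))
    where
    alive≤1 : ∀ d l r → l ℕ.+ r ℕ.+ d ≡ n → alive d l r ≤ 1ℚ
    alive≤1 zero    l r eq = nonNegative⁻¹ 1ℚ
    alive≤1 (suc d) l r eq = ≤-refl
    certain : ∀ l r → walk (λ _ _ _ → 1ℚ) d l r ≡ 1ℚ
    certain zero    zero    = refl
    certain zero    (suc r) = refl
    certain (suc l) zero    = refl
    certain (suc l) (suc r) = refl
  alive-antitone (suc m) (suc d) l r eq = walk-mono (alive-antitone m) d l r eq

-- The sum of k+1, ..., k+d; `later 0 n` is the triangular number n(n+1)/2.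
later : ℕ → ℕ → ℕ
later k zero    = 0
later k (suc d) = suc k ℕ.+ later (suc k) d

-- Gambler's ruin: (l+1)(r+1) is the expected time to leave the arc of k = l+r+1 visited nodes,
-- and each later arc of j nodes is entered at an end, which costs 1·j steps.
remaining : ℕ → ℕ → ℕ → ℕ
remaining zero    l r = 0
remaining (suc d) l r = suc l ℕ.* suc r ℕ.+ later (suc (l ℕ.+ r)) d

-- At an end of the enlarged arc the product is (l+2) · 1, exactly the first term of `later`. Thus
-- leaving the old arc on either side leads to the same value.
remaining-enter : ∀ l d → remaining d (suc l) 0 ≡ later (suc (l ℕ.+ 0)) d
remaining-enter l zero    = refl
remaining-enter l (suc d) = cong (ℕ._+ later (suc (suc (l ℕ.+ 0))) d) (identity l)
  where
  identity : ∀ l → suc (suc l) ℕ.* 1 ≡ suc (suc (l ℕ.+ 0))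
  identity = ℕ-Solver.solve-∀

remaining-enter′ : ∀ r d → remaining d 0 (suc r) ≡ later (suc r) d
remaining-enter′ r zero    = refl
remaining-enter′ r (suc d) = cong (ℕ._+ later (suc (suc r)) d) (ℕ.*-identityˡ (suc (suc r)))

-- Doubled to stay in ℕ, this is 2(l+1)(r+1) = 2 + (l+2)r + l(r+2). Just outside the arc the product
-- vanishes, which matches the boundary value `later`.
remaining-harmonic : ∀ d l r → ι (remaining d l r) ≡ alive d l r + evolve (λ d l r → ι (remaining d l r)) 1 d l r
remaining-harmonic zero    l r = ι-0
remaining-harmonic (suc d) l r = average l r
  where
  open ≡-Reasoning
  F : ℕ → ℕ → ℕ → ℚ
  F d l r = ι (remaining d l r)
  halves : ∀ {v f b} → v ℕ.+ v ≡ 2 ℕ.+ (f ℕ.+ b) → ι v ≡ 1ℚ + (½ * ι f + ½ * ι b)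
  halves {v} {f} {b} eq = begin
    ι v                                   ≡⟨ double (ι v) ⟨
    ½ * (ι v + ι v)                       ≡⟨ cong (½ *_) (trans (sym (ι-+ v v)) (cong ι eq)) ⟩
    ½ * ι (2 ℕ.+ (f ℕ.+ b))               ≡⟨ cong (½ *_) (trans (ι-suc _) (cong (λ t → 1ℚ + t) (trans (ι-suc _) (cong (λ t → 1ℚ + t) (ι-+ f b))))) ⟩
    ½ * (1ℚ + (1ℚ + (ι f + ι b)))         ≡⟨ expand (ι f) (ι b) ⟩
    1ℚ + (½ * ι f + ½ * ι b)              ∎
    where
    double : ∀ x → ½ * (x + x) ≡ x
    double = solve-∀ ℚ-ring
    expand : ∀ f b → ½ * (1ℚ + (1ℚ + (f + b))) ≡ 1ℚ + (½ * f + ½ * b)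
    expand = solve-∀ ℚ-ring
  average : ∀ l r → F (suc d) l r ≡ 1ℚ + walk F d l r
  average zero    zero    = halves (trans (identity (later 1 d)) (cong (2 ℕ.+_) (sym (cong₂ ℕ._+_ (remaining-enter 0 d) (remaining-enter′ 0 d)))))
    where
    identity : ∀ k → (1 ℕ.+ k) ℕ.+ (1 ℕ.+ k) ≡ 2 ℕ.+ (k ℕ.+ k)
    identity = ℕ-Solver.solve-∀
  average zero    (suc r) = halves (trans (identity r (later (suc (suc r)) d)) (cong (λ t → 2 ℕ.+ (2 ℕ.* suc r ℕ.+ later (suc (suc r)) d ℕ.+ t)) (sym (remaining-enter′ (suc r) d))))
    where
    identity : ∀ r k → (1 ℕ.* suc (suc r) ℕ.+ k) ℕ.+ (1 ℕ.* suc (suc r) ℕ.+ k) ≡ 2 ℕ.+ (2 ℕ.* suc r ℕ.+ k ℕ.+ k)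
    identity = ℕ-Solver.solve-∀
  average (suc l) zero    = halves (trans (identity l (later (suc (suc l ℕ.+ 0)) d)) (cong (2 ℕ.+_) (cong₂ ℕ._+_ (sym (remaining-enter (suc l) d))
      (cong (λ k → suc l ℕ.* 2 ℕ.+ later (suc k) d) (sym (ℕ.+-suc l 0))))))
    where
    identity : ∀ l k → (suc (suc l) ℕ.* 1 ℕ.+ k) ℕ.+ (suc (suc l) ℕ.* 1 ℕ.+ k) ≡ 2 ℕ.+ (k ℕ.+ (suc l ℕ.* 2 ℕ.+ k))
    identity = ℕ-Solver.solve-∀
  average (suc l) (suc r) = halves (trans (identity l r (later (suc (suc l ℕ.+ suc r)) d)) (cong (2 ℕ.+_) (cong₂ ℕ._+_
      (cong (λ k → suc (suc (suc l)) ℕ.* suc r ℕ.+ later (suc k) d) (cong suc (ℕ.+-suc l r)))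
      (cong (λ k → suc l ℕ.* suc (suc (suc r)) ℕ.+ later (suc k) d) (sym (ℕ.+-suc l (suc r)))))))
    where
    identity : ∀ l r k → (suc (suc l) ℕ.* suc (suc r) ℕ.+ k) ℕ.+ (suc (suc l) ℕ.* suc (suc r) ℕ.+ k)
      ≡ 2 ℕ.+ ((suc (suc (suc l)) ℕ.* suc r ℕ.+ k) ℕ.+ (suc l ℕ.* suc (suc (suc r)) ℕ.+ k))
    identity = ℕ-Solver.solve-∀

remaining-bound : ∀ {n} d l r → l ℕ.+ r ℕ.+ d ≡ n → ι (remaining d l r) ≤ ι (n ℕ.* n) * alive d l r
remaining-bound {n} zero    l r eq = ≤-reflexive (trans ι-0 (sym (*-zeroʳ (ι (n ℕ.* n)))))
remaining-bound {n} (suc d) l r refl = ≤-trans (ι-mono bound) (≤-reflexive (sym (*-identityʳ (ι (n ℕ.* n)))))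
  where
  open ℕ.≤-Reasoning
  later-bound : ∀ k d → later k d ℕ.≤ d ℕ.* (k ℕ.+ d)
  later-bound k zero    = z≤n
  later-bound k (suc d) = ℕ.+-mono-≤ (ℕ.≤-trans (ℕ.m≤m+n (suc k) d) (ℕ.≤-reflexive (sym (ℕ.+-suc k d))))
    (ℕ.≤-trans (later-bound (suc k) d) (ℕ.≤-reflexive (cong (d ℕ.*_) (sym (ℕ.+-suc k d)))))
  s = suc (l ℕ.+ r)
  s+d≡n : s ℕ.+ d ≡ n
  s+d≡n = sym (ℕ.+-suc (l ℕ.+ r) d)
  bound : suc l ℕ.* suc r ℕ.+ later s d ℕ.≤ n ℕ.* n
  bound = begin
    suc l ℕ.* suc r ℕ.+ later s d   ≤⟨ ℕ.+-mono-≤ (ℕ.*-mono-≤ (s≤s (ℕ.m≤m+n l r)) (ℕ.≤-trans (s≤s (ℕ.m≤n+m r l)) (ℕ.m≤m+n s d))) (later-bound s d) ⟩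
    s ℕ.* (s ℕ.+ d) ℕ.+ d ℕ.* (s ℕ.+ d)     ≡⟨ ℕ.*-distribʳ-+ (s ℕ.+ d) s d ⟨
    (s ℕ.+ d) ℕ.* (s ℕ.+ d)         ≡⟨ cong (λ k → k ℕ.* k) s+d≡n ⟩
    n ℕ.* n                         ∎

triangle : ∀ k d → 2 ℕ.* (later k d) ≡ d ℕ.* (suc d ℕ.+ (k ℕ.+ k))
triangle k zero    = refl
triangle k (suc d) = trans (ℕ.*-distribˡ-+ 2 (suc k) (later (suc k) d)) (trans (cong (2 ℕ.* suc k ℕ.+_) (triangle (suc k) d)) (identity k d))
  where
  identity : ∀ k d → 2 ℕ.* suc k ℕ.+ d ℕ.* (suc d ℕ.+ (suc k ℕ.+ suc k)) ≡ suc d ℕ.* (suc (suc d) ℕ.+ (k ℕ.+ k))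
  identity = ℕ-Solver.solve-∀

remaining-later : ∀ n → remaining n 0 0 ≡ later 0 n
remaining-later zero    = refl
remaining-later (suc n) = refl

remaining-start : ∀ n → ι (remaining n 0 0) ≡ + (suc n ℕ.* n) / 2
remaining-start n = trans (cong ι (remaining-later n)) (trans (sym (cancel (ι (later 0 n))))
  (trans (cong (½ *_) (trans (cong (_* ι (later 0 n)) (sym ι-2)) (trans (sym (ι-* 2 (later 0 n))) (cong ι (trans (triangle 0 n) (identity n))))))
    (sym (half-ι (suc n ℕ.* n)))))
  where
  identity : ∀ n → n ℕ.* (suc n ℕ.+ 0) ≡ suc n ℕ.* n
  identity = ℕ-Solver.solve-∀
  ι-2 : ι 2 ≡ 1ℚ + 1ℚ
  ι-2 = trans (ι-suc 1) (cong (λ t → 1ℚ + t) ι-1)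
  cancel : ∀ x → ½ * ((1ℚ + 1ℚ) * x) ≡ x
  cancel = solve-∀ ℚ-ring

coverTime-rw : ∀ n → ExpectedCoverTime {n} πrw (+ (suc n ℕ.* n) / 2)
-- The constant is n² V(start), from M e M ≤ n² M f M ≤ n² (f 0 + ... + f (M-1)) ≤ n² V(start).
coverTime-rw n = converges-from-error (partialE πrw) e (n ℕ.* n ℕ.* remaining n 0 0)
  (λ M → trans (cong (_+ e M) (partial M)) (trans (total M) (remaining-start n)))
  (λ M → evolve-nonNegative (λ d l r → 0≤ι (remaining d l r)) M n 0 0)
  (λ M → begin
    ι M * e M                                     ≤⟨ *-monoˡ-≤-nonNeg (ι M) {{nonNegative (0≤ι M)}} (evolve-bounded (ι (n ℕ.* n)) remaining-bound M n 0 0 refl) ⟩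
    ι M * (ι (n ℕ.* n) * f M)                     ≡⟨ exchange (ι M) (ι (n ℕ.* n)) (f M) ⟩
    ι (n ℕ.* n) * (ι M * f M)                     ≤⟨ *-monoˡ-≤-nonNeg (ι (n ℕ.* n)) {{nonNegative (0≤ι (n ℕ.* n))}} (sum-bound M) ⟩
    ι (n ℕ.* n) * ι (remaining n 0 0)             ≡⟨ ι-* (n ℕ.* n) (remaining n 0 0) ⟨
    ι (n ℕ.* n ℕ.* remaining n 0 0)               ∎)
  where
  open ≤-Reasoning
  f e : ℕ → ℚ
  f m = evolve alive m n 0 0
  e m = evolve (λ d l r → ι (remaining d l r)) m n 0 0
  exchange : ∀ a b c → a * (b * c) ≡ b * (a * c)
  exchange = solve-∀ ℚ-ring
  partial : ∀ M → partialE {n} πrw M ≡ sumℚ (applyUpTo f M)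
  partial M = trans (partialE-survival πrw M) (sum-cong (λ m → survival-rw m n refl arc-start) M)
  total : ∀ M → sumℚ (applyUpTo f M) + e M ≡ ι (remaining n 0 0)
  total = telescope f e (λ m → evolve-additive remaining-harmonic m n 0 0)
  sum-bound : ∀ M → ι M * f M ≤ ι (remaining n 0 0)
  sum-bound M = ≤-trans (antitone-sum f (λ m → alive-antitone m n 0 0 refl) M)
    (subst₂ _≤_ (+-identityʳ (sumℚ (applyUpTo f M))) (total M)
      (+-monoʳ-≤ (sumℚ (applyUpTo f M)) (evolve-nonNegative (λ d l r → 0≤ι (remaining d l r)) M n 0 0)))

-- Negative feedback: the balance equation

-- The sum over the bit lists of length l that end in true, each with weight 2⁻ˡ; ∫⁺ omits the
-- empty list.  The last bit belongs to an outermost visited node, which was never left outwards.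
∫ ∫⁺ : ∀ l → (Vec Bool l → ℚ) → ℚ
∫ zero    f = f []
∫ (suc l) f = ½ * (∫ l (λ bs → f (true ∷ bs)) + ∫⁺ l (λ bs → f (false ∷ bs)))
∫⁺ zero    f = 0ℚ
∫⁺ (suc l) f = ∫ (suc l) f

∫-cong  : ∀ l {f g} → (∀ bs → f bs ≡ g bs) → ∫ l f ≡ ∫ l g
∫⁺-cong : ∀ l {f g} → (∀ bs → f bs ≡ g bs) → ∫⁺ l f ≡ ∫⁺ l g
∫-cong zero    eq = eq []
∫-cong (suc l) eq = cong (½ *_) (cong₂ _+_ (∫-cong l (λ bs → eq (true ∷ bs))) (∫⁺-cong l (λ bs → eq (false ∷ bs))))
∫⁺-cong zero    eq = refl
∫⁺-cong (suc l) eq = ∫-cong (suc l) eq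

∫-average  : ∀ l f g → ∫ l (λ bs → ½ * (f bs + g bs)) ≡ ½ * (∫ l f + ∫ l g)
∫⁺-average : ∀ l f g → ∫⁺ l (λ bs → ½ * (f bs + g bs)) ≡ ½ * (∫⁺ l f + ∫⁺ l g)
∫-average zero    f g = refl
∫-average (suc l) f g = trans
  (cong (½ *_) (cong₂ _+_ (∫-average l (λ bs → f (true ∷ bs)) (λ bs → g (true ∷ bs))) (∫⁺-average l (λ bs → f (false ∷ bs)) (λ bs → g (false ∷ bs)))))
  (interchange (∫ l (λ bs → f (true ∷ bs))) (∫ l (λ bs → g (true ∷ bs))) (∫⁺ l (λ bs → f (false ∷ bs))) (∫⁺ l (λ bs → g (false ∷ bs))))
  where
  interchange : ∀ a b c d → ½ * (½ * (a + b) + ½ * (c + d)) ≡ ½ * (½ * (a + c) + ½ * (b + d))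
  interchange = solve-∀ ℚ-ring
∫⁺-average zero    f g = refl
∫⁺-average (suc l) f g = ∫-average (suc l) f g

∫-zero  : ∀ l → ∫ l (λ _ → 0ℚ) ≡ 0ℚ
∫⁺-zero : ∀ l → ∫⁺ l (λ _ → 0ℚ) ≡ 0ℚ
∫-zero zero    = refl
∫-zero (suc l) = cong (½ *_) (cong₂ _+_ (∫-zero l) (∫⁺-zero l))
∫⁺-zero zero    = refl
∫⁺-zero (suc l) = ∫-zero (suc l)

∫-nonNegative  : ∀ l {f} → (∀ bs → 0ℚ ≤ f bs) → 0ℚ ≤ ∫ l f
∫⁺-nonNegative : ∀ l {f} → (∀ bs → 0ℚ ≤ f bs) → 0ℚ ≤ ∫⁺ l f
∫-nonNegative zero    0≤f = 0≤f []
∫-nonNegative (suc l) 0≤f = *-monoˡ-≤-nonNeg ½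
  (+-mono-≤ (∫-nonNegative l (λ bs → 0≤f (true ∷ bs))) (∫⁺-nonNegative l (λ bs → 0≤f (false ∷ bs))))
∫⁺-nonNegative zero    0≤f = ≤-refl
∫⁺-nonNegative (suc l) 0≤f = ∫-nonNegative (suc l) 0≤f

module _ (φ : State → ℚ) (l r : ℕ) where

  ∬-balanced ∬⁺-balanced ∬-forward ∬-backward occupation : ℚ
  ∬-balanced  = ∫ l (λ ls → ∫ r (λ rs → φ ⟨ ls , balanced , rs ⟩))
  ∬⁺-balanced = ∫⁺ l (λ ls → ∫⁺ r (λ rs → φ ⟨ ls , balanced , rs ⟩))
  ∬-forward   = ∫ l (λ ls → ∫⁺ r (λ rs → φ ⟨ ls , forward , rs ⟩))
  ∬-backward  = ∫⁺ l (λ ls → ∫ r (λ rs → φ ⟨ ls , backward , rs ⟩))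
  -- Every state has a single possible time (see clock) and is visited with probability 2⁻ˡ⁻ʳ,
  -- halved if its centre is not balanced: each visited node other than the walker's has its last
  -- pair of exits, or its last single exit, prescribed.
  occupation  = ∬-balanced + ½ * (∬-forward + ∬-backward)

  -- The part of the occupation that arrives by a step inside the arc. A backward lean arises only
  -- from a forward arrival, and a forward lean only from a backward one; a balanced centre with
  -- nodes on both sides receives equal weight from each.
  forwardInflow backwardInflow : ℚ
  forwardInflow  = ½ * (∬-backward + ∬⁺-balanced)
  backwardInflow = ½ * (∬-forward + ∬⁺-balanced)

module _ (F : Observable) (d : ℕ) (l r : ℕ) where

  forwardFlow backwardFlow : ℚ
  forwardFlow  = ∫ (suc l) (λ ls → ∫ r (λ rs → goForward F d ls rs))
  backwardFlow = ∫ l (λ ls → ∫ (suc r) (λ rs → goBackward F d ls rs))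

  occupation-next : occupation (next F d) l r ≡ forwardFlow + backwardFlow
  occupation-next = begin
    ∫ l (λ ls → ∫ r (λ rs → ½ * f true ls rs + ½ * b true ls rs)) + ½ * (B + A)
      ≡⟨ cong (_+ ½ * (B + A)) (trans
           (∫-cong l (λ ls → trans (∫-cong r (λ rs → sym (*-distribˡ-+ ½ (f true ls rs) (b true ls rs)))) (∫-average r (f true ls) (b true ls))))
           (∫-average l (λ ls → ∫ r (f true ls)) (λ ls → ∫ r (b true ls)))) ⟩
    ½ * (∫ l (λ ls → ∫ r (f true ls)) + ∫ l (λ ls → ∫ r (b true ls))) + ½ * (B + A)
      ≡⟨ regroup (∫ l (λ ls → ∫ r (f true ls))) (∫ l (λ ls → ∫ r (b true ls))) B A ⟩
    forwardFlow + ½ * (∫ l (λ ls → ∫ r (b true ls)) + B)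
      ≡⟨ cong (λ t → forwardFlow + t) (∫-average l (λ ls → ∫ r (b true ls)) (λ ls → ∫⁺ r (b false ls))) ⟨
    forwardFlow + backwardFlow ∎
    where
    open ≡-Reasoning
    f b : Bool → Vec Bool l → Vec Bool r → ℚ
    f a ls rs = goForward F d (a ∷ ls) rs
    b a ls rs = goBackward F d ls (a ∷ rs)
    A = ∫⁺ l (λ ls → ∫ r (f false ls))
    B = ∫ l (λ ls → ∫⁺ r (b false ls))
    regroup : ∀ x y b a → ½ * (x + y) + ½ * (b + a) ≡ ½ * (x + a) + ½ * (y + b)
    regroup = solve-∀ ℚ-ring

-- The recursion of `∫` read the other way: the nearest bit ahead is consumed and becomes the lean
-- of the new centre, `true` giving backward and `false` balanced.
forwardFlow-inside : ∀ F d l r → forwardFlow F d l (suc r) ≡ forwardInflow (F (suc d)) (suc l) r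
forwardFlow-inside F d l r = ∫-average (suc l)
  (λ ls → ∫ r (λ rs → F (suc d) ⟨ ls , backward , rs ⟩)) (λ ls → ∫⁺ r (λ rs → F (suc d) ⟨ ls , balanced , rs ⟩))

backwardFlow-inside : ∀ F d l r → backwardFlow F d (suc l) r ≡ backwardInflow (F (suc d)) l (suc r)
backwardFlow-inside F d l r = refl

-- `diagonal k 0` ranges over all positions of the walker on an arc of k + 1 nodes; other starting
-- points serve the inductions.
diagonal : ℕ → ℕ → (ℕ → ℕ → ℚ) → ℚ
diagonal zero    r T = T 0 r
diagonal (suc l) r T = T (suc l) r + diagonal l (suc r) T

diagonal-cong : ∀ l r {T U} → (∀ l r → T l r ≡ U l r) → diagonal l r T ≡ diagonal l r U
diagonal-cong zero    r eq = eq 0 r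
diagonal-cong (suc l) r eq = cong₂ _+_ (eq (suc l) r) (diagonal-cong l (suc r) eq)

diagonal-+ : ∀ l r T U → diagonal l r (λ l r → T l r + U l r) ≡ diagonal l r T + diagonal l r U
diagonal-+ zero    r T U = refl
diagonal-+ (suc l) r T U = trans (cong (λ t → T (suc l) r + U (suc l) r + t) (diagonal-+ l (suc r) T U))
  (interchange (T (suc l) r) (U (suc l) r) (diagonal l (suc r) T) (diagonal l (suc r) U))
  where
  interchange : ∀ a b c d → a + b + (c + d) ≡ a + c + (b + d)
  interchange = solve-∀ ℚ-ring

diagonal-shift : ∀ T U → (∀ l r → T l (suc r) ≡ U (suc l) r) → (∀ r → U 0 r ≡ 0ℚ) →
  ∀ l r → diagonal l (suc r) T ≡ diagonal (suc l) r U
diagonal-shift T U eq U0 zero    r = trans (eq 0 r) (trans (sym (+-identityʳ (U 1 r))) (cong (λ t → U 1 r + t) (sym (U0 (suc r)))))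
diagonal-shift T U eq U0 (suc l) r = cong₂ _+_ (eq (suc l) r) (diagonal-shift T U eq U0 l (suc r))

-- Forward steps shift positions by one. The flow out of the right end is left over, and nothing
-- arrives at the left end.
diagonal-shiftʳ : ∀ T U → (∀ l r → T l (suc r) ≡ U (suc l) r) → (∀ r → U 0 r ≡ 0ℚ) →
  ∀ k → diagonal k 0 T ≡ T k 0 + diagonal k 0 U
diagonal-shiftʳ T U eq U0 zero    = trans (sym (+-identityʳ (T 0 0))) (cong (λ t → T 0 0 + t) (sym (U0 0)))
diagonal-shiftʳ T U eq U0 (suc k) = cong (λ t → T (suc k) 0 + t) (diagonal-shift T U eq U0 k 0)

diagonal-unshift : ∀ T U → (∀ l r → T (suc l) r ≡ U l (suc r)) →
  ∀ l r → diagonal (suc l) r T ≡ diagonal l (suc r) U + T 0 (suc l ℕ.+ r)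
diagonal-unshift T U eq zero    r = cong (_+ T 0 (suc r)) (eq 0 r)
diagonal-unshift T U eq (suc l) r = trans
  (cong₂ _+_ (eq (suc l) r) (trans (diagonal-unshift T U eq l (suc r)) (cong (λ k → diagonal l (suc (suc r)) U + T 0 k) (ℕ.+-suc (suc l) r))))
  (sym (+-assoc (U (suc l) (suc r)) (diagonal l (suc (suc r)) U) (T 0 (suc (suc l) ℕ.+ r))))

diagonal-shiftˡ : ∀ T U → (∀ l r → T (suc l) r ≡ U l (suc r)) → (∀ l → U l 0 ≡ 0ℚ) →
  ∀ k → diagonal k 0 T ≡ diagonal k 0 U + T 0 k
diagonal-shiftˡ T U eq U0 zero    = trans (sym (+-identityˡ (T 0 0))) (cong (_+ T 0 0) (sym (U0 0)))
diagonal-shiftˡ T U eq U0 (suc k) = trans (diagonal-unshift T U eq k 0) (cong₂ _+_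
  (trans (sym (+-identityˡ (diagonal k 1 U))) (cong (_+ diagonal k 1 U) (sym (U0 (suc k)))))
  (cong (T 0) (ℕ.+-identityʳ (suc k))))

module _ (φ : State → ℚ) where

  -- φ paired with the law of the state at the first visit to the (k+1)-th node: the walker is then
  -- at an end of the arc, on a balanced node.
  discovery : ℕ → ℚ
  discovery zero    = φ ⟨ [] , balanced , [] ⟩
  discovery (suc k) = ∬-balanced φ (suc k) 0 + ∬-balanced φ 0 (suc k)

  private
    extremal : ℕ → ℕ → ℚ
    extremal zero    r       = ∬-balanced φ 0 r
    extremal (suc l) zero    = ∬-balanced φ (suc l) 0
    extremal (suc l) (suc r) = 0ℚ

    inflow : ℕ → ℕ → ℚ
    inflow l r = forwardInflow φ l r + backwardInflow φ l r

    -- In the interior the balanced weight is halved between the two directions. At an end, the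
    -- outermost bit `true` makes every return arrive with a lean, so the balanced weight there is
    -- due to discovery.
    occupation-split : ∀ l r → occupation φ l r ≡ inflow l r + extremal l r
    occupation-split zero r = identity (∬-balanced φ 0 r) (∬-forward φ 0 r)
      where
      identity : ∀ x f → x + ½ * (f + 0ℚ) ≡ ½ * (0ℚ + 0ℚ) + ½ * (f + 0ℚ) + x
      identity = solve-∀ ℚ-ring
    occupation-split (suc l) zero = trans (identity (∬-balanced φ (suc l) 0) (∬-backward φ (suc l) 0) (∬-forward φ (suc l) 0))
      (cong (λ z → ½ * (∬-backward φ (suc l) 0 + z) + ½ * (∬-forward φ (suc l) 0 + z) + ∬-balanced φ (suc l) 0) (sym (∫-zero (suc l))))
      where
      identity : ∀ x b f → x + ½ * (f + b) ≡ ½ * (b + 0ℚ) + ½ * (f + 0ℚ) + x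
      identity = solve-∀ ℚ-ring
    occupation-split (suc l) (suc r) = identity (∬-balanced φ (suc l) (suc r)) (∬-backward φ (suc l) (suc r)) (∬-forward φ (suc l) (suc r))
      where
      identity : ∀ x b f → x + ½ * (f + b) ≡ ½ * (b + x) + ½ * (f + x) + 0ℚ
      identity = solve-∀ ℚ-ring

    diagonal-extremal : ∀ l r → diagonal l (suc r) extremal ≡ ∬-balanced φ 0 (l ℕ.+ suc r)
    diagonal-extremal zero    r = refl
    diagonal-extremal (suc l) r = trans (+-identityˡ _) (trans (diagonal-extremal l (suc r)) (cong (∬-balanced φ 0) (ℕ.+-suc l (suc r))))

    diagonal-discovery : ∀ k → diagonal k 0 extremal ≡ discovery k
    diagonal-discovery zero    = refl
    diagonal-discovery (suc k) = cong (λ t → ∬-balanced φ (suc k) 0 + t)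
      (trans (diagonal-extremal k 0) (cong (∬-balanced φ 0) (ℕ.+-comm k 1)))

  diagonal-occupation : ∀ k → diagonal k 0 (occupation φ) ≡
    diagonal k 0 (forwardInflow φ) + diagonal k 0 (backwardInflow φ) + discovery k
  diagonal-occupation k = trans (diagonal-cong k 0 occupation-split) (trans (diagonal-+ k 0 inflow extremal)
    (cong₂ _+_ (diagonal-+ k 0 (forwardInflow φ) (backwardInflow φ)) (diagonal-discovery k)))

diagonal-occupation-next : ∀ F d k → diagonal k 0 (occupation (next F d)) ≡
  diagonal k 0 (forwardInflow (F (suc d))) + diagonal k 0 (backwardInflow (F (suc d))) + discovery (F d) (suc k)
diagonal-occupation-next F d k = trans (diagonal-cong k 0 (occupation-next F d)) (trans (diagonal-+ k 0 (forwardFlow F d) (backwardFlow F d))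
  (trans (cong₂ _+_ (diagonal-shiftʳ (forwardFlow F d) (forwardInflow (F (suc d))) (forwardFlow-inside F d) (λ _ → refl) k)
                    (diagonal-shiftˡ (backwardFlow F d) (backwardInflow (F (suc d))) (backwardFlow-inside F d) emptyRight k))
    (regroup (forwardFlow F d k 0) (diagonal k 0 (forwardInflow (F (suc d)))) (diagonal k 0 (backwardInflow (F (suc d)))) (backwardFlow F d 0 k))))
  where
  regroup : ∀ a x y b → a + x + (y + b) ≡ x + y + (a + b)
  regroup = solve-∀ ℚ-ring
  emptyRight : ∀ l → backwardInflow (F (suc d)) l 0 ≡ 0ℚ
  emptyRight l = cong (½ *_) (cong₂ _+_ (∫-zero l) (∫⁺-zero l))

-- F paired with G, restricted to arcs of k+1, ..., k+d nodes.
total : ℕ → ℕ → Observable → ℚ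
total k zero    F = 0ℚ
total k (suc d) F = diagonal k 0 (occupation (F (suc d))) + total (suc k) d F

-- On each arc size, arrivals are inner flow plus discovery of the present arc, departures the same
-- inner flow plus discovery of the next; the latter cancels against the source in the induction
-- hypothesis. For k = 0 the source is the starting state.
total-balance : ∀ m k d → total k d (negSurvival m) ≡ discovery (negSurvival m d) k + total k d (negSurvival (suc m))
total-balance m k zero = sym (trans (+-identityʳ (discovery (λ _ → 0ℚ) k)) (none k))
  where
  none : ∀ k → discovery (λ _ → 0ℚ) k ≡ 0ℚ
  none zero    = refl
  none (suc k) = cong₂ _+_ (∫-zero (suc k)) (∫-zero (suc k))
total-balance m k (suc d) = begin
  diagonal k 0 (occupation (F (suc d))) + total (suc k) d F
    ≡⟨ cong₂ _+_ (diagonal-occupation (F (suc d)) k) (total-balance m (suc k) d) ⟩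
  diagonal k 0 (forwardInflow (F (suc d))) + diagonal k 0 (backwardInflow (F (suc d))) + discovery (F (suc d)) k
    + (discovery (F d) (suc k) + total (suc k) d F′)
    ≡⟨ regroup (diagonal k 0 (forwardInflow (F (suc d))) + diagonal k 0 (backwardInflow (F (suc d)))) (discovery (F (suc d)) k) (discovery (F d) (suc k)) _ ⟩
  discovery (F (suc d)) k + (diagonal k 0 (forwardInflow (F (suc d))) + diagonal k 0 (backwardInflow (F (suc d))) + discovery (F d) (suc k)
    + total (suc k) d F′)
    ≡⟨ cong (λ t → discovery (F (suc d)) k + (t + total (suc k) d F′)) (diagonal-occupation-next F d k) ⟨
  discovery (F (suc d)) k + (diagonal k 0 (occupation (next F d)) + total (suc k) d F′) ∎
  where
  open ≡-Reasoning
  F F′ : Observable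
  F  = negSurvival m
  F′ = negSurvival (suc m)
  regroup : ∀ i e x t → i + e + (x + t) ≡ e + (i + x + t)
  regroup = solve-∀ ℚ-ring

negSurvival-nonNegative : ∀ m d σ → 0ℚ ≤ negSurvival m d σ
negSurvival-nonNegative m       zero    σ = ≤-refl
negSurvival-nonNegative zero    (suc d) σ = nonNegative⁻¹ 1ℚ
negSurvival-nonNegative (suc m) (suc d) ⟨ ls , c , rs ⟩ = moves c
  where
  forwards : ∀ {l r} (ls : Vec Bool l) (rs : Vec Bool r) → 0ℚ ≤ goForward (negSurvival m) d ls rs
  forwards ls []       = negSurvival-nonNegative m d _
  forwards ls (b ∷ rs) = negSurvival-nonNegative m (suc d) _
  backwards : ∀ {l r} (ls : Vec Bool l) (rs : Vec Bool r) → 0ℚ ≤ goBackward (negSurvival m) d ls rs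
  backwards []       rs = negSurvival-nonNegative m d _
  backwards (b ∷ ls) rs = negSurvival-nonNegative m (suc d) _
  moves : ∀ c → 0ℚ ≤ next (negSurvival m) d ⟨ ls , c , rs ⟩
  moves balanced = +-mono-≤ (*-monoˡ-≤-nonNeg ½ (forwards (true ∷ ls) rs)) (*-monoˡ-≤-nonNeg ½ (backwards ls (true ∷ rs)))
  moves forward  = backwards ls (false ∷ rs)
  moves backward = forwards (false ∷ ls) rs

total-nonNegative : ∀ m k d → 0ℚ ≤ total k d (negSurvival m)
total-nonNegative m k zero    = ≤-refl
total-nonNegative m k (suc d) = +-mono-≤ (diagonal-nonNegative k 0) (total-nonNegative m (suc k) d)
  where
  φ = negSurvival m (suc d)
  0≤φ = negSurvival-nonNegative m (suc d)
  occupation-nonNegative : ∀ l r → 0ℚ ≤ occupation φ l r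
  occupation-nonNegative l r = +-mono-≤ (∫-nonNegative l (λ ls → ∫-nonNegative r (λ rs → 0≤φ _)))
    (*-monoˡ-≤-nonNeg ½ (+-mono-≤ (∫-nonNegative l (λ ls → ∫⁺-nonNegative r (λ rs → 0≤φ _)))
                                  (∫⁺-nonNegative l (λ ls → ∫-nonNegative r (λ rs → 0≤φ _)))))
  diagonal-nonNegative : ∀ l r → 0ℚ ≤ diagonal l r (occupation φ)
  diagonal-nonNegative zero    r = occupation-nonNegative 0 r
  diagonal-nonNegative (suc l) r = +-mono-≤ (occupation-nonNegative (suc l) r) (diagonal-nonNegative l (suc r))

∫-const : ∀ l c → ∫ (suc l) (λ _ → c) ≡ ½ * c
∫-const zero    c = cong (½ *_) (+-identityʳ c)
∫-const (suc l) c = trans (cong (½ *_) (cong₂ _+_ (∫-const l c) (∫-const l c))) (double c)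
  where
  double : ∀ c → ½ * (½ * c + ½ * c) ≡ ½ * c
  double = solve-∀ ℚ-ring

-- The values are 1, 3/4 and 1/2 when none, one or both sides are nonempty.
occupation-one : ∀ l r → occupation (λ _ → 1ℚ) l r ≤ 1ℚ
occupation-one zero zero = ≤-refl
occupation-one zero (suc r) rewrite ∫-const r 1ℚ = from-yes (½ + ½ * (½ + 0ℚ) ≤? 1ℚ)
occupation-one (suc l) zero rewrite ∫-const l 1ℚ | ∫-const l 0ℚ = from-yes (½ + ½ * (0ℚ + ½) ≤? 1ℚ)
occupation-one (suc l) (suc r) rewrite ∫-const r 1ℚ | ∫-const l (½ * 1ℚ) = from-yes (½ * ½ + ½ * (½ * ½ + ½ * ½) ≤? 1ℚ)

diagonal-one : ∀ l r → diagonal l r (occupation (λ _ → 1ℚ)) ≤ ι (suc l)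
diagonal-one zero    r = ≤-trans (occupation-one 0 r) (≤-reflexive (sym ι-1))
diagonal-one (suc l) r = ≤-trans (+-mono-≤ (occupation-one (suc l) r) (diagonal-one l (suc r))) (≤-reflexive (sym (ι-suc (suc l))))

total-one : ∀ k d → total k d (negSurvival 0) ≤ ι (later k d)
total-one k zero    = ≤-reflexive (sym ι-0)
total-one k (suc d) = ≤-trans (+-mono-≤ (diagonal-one k 0) (total-one (suc k) d)) (≤-reflexive (sym (ι-+ (suc k) (later (suc k) d))))

-- Arcs of one node give 1 on both sides. The strict inequality comes from arcs of two nodes, 3/2
-- against 2, which for n ≥ 2 do not yet cover the cycle.
total-one-strict : ∀ n → 2 ℕ.≤ n → total 0 n (negSurvival 0) < ι (later 0 n)
total-one-strict (suc (suc n)) (s≤s (s≤s z≤n)) = <-≤-trans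
  (+-mono-≤-< {1ℚ} ≤-refl (+-mono-<-≤ {u = total 2 n (negSurvival 0)} second (total-one 2 n)))
  (≤-reflexive (sym (trans (ι-+ 1 (later 1 (suc n))) (cong₂ _+_ ι-1 (ι-+ 2 (later 2 n))))))
  where
  ι-2 : ι 2 ≡ 1ℚ + 1ℚ
  ι-2 = trans (ι-suc 1) (cong (λ t → 1ℚ + t) ι-1)
  second : diagonal 1 0 (occupation (λ _ → 1ℚ)) < ι 2
  second = <-≤-trans (from-yes (diagonal 1 0 (occupation (λ _ → 1ℚ)) <? (1ℚ + 1ℚ))) (≤-reflexive (sym ι-2))

-- Negative feedback: the clock

bit : Bool → ℕ
bit true  = 1
bit false = 0

-- `moment` is the sum of the distances to the walker of the nodes with bit `true`; the tail lies
-- one step further away, hence the extra `ones bs`.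
ones moment : ∀ {l} → Vec Bool l → ℕ
ones []       = 0
ones (b ∷ bs) = bit b ℕ.+ ones bs
moment []       = 0
moment (b ∷ bs) = bit b ℕ.+ (moment bs ℕ.+ ones bs)

tilt : Lean → ℤ
tilt balanced = + 0
tilt forward  = + 1
tilt backward = ℤ.- + 1

clockOf : ℤ → ℤ → ℤ → ℤ
clockOf p q s = + 2 ℤ.* (p ℤ.+ q) ℤ.- s ℤ.* s

-- If S_v ∈ {−1, 0, 1} is the lean of node v and X₀ = 0, then X = Σ S_v and X² − 2 Σ v S_v grows by
-- one in every step.  Measuring nodes from the walker turns it into −X² − 2 Σ (v − X) S_v.
clock : State → ℤ
clock ⟨ ls , c , rs ⟩ = clockOf (+ moment ls) (+ moment rs) (+ ones ls ℤ.- + ones rs ℤ.+ tilt c)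

tilt-exit : ∀ {c a} → Exit c a → + bit a ≡ tilt c ℤ.+ + 1
tilt-exit from-balanced = refl
tilt-exit from-backward = refl

clock-discover : ∀ {c a l} {ls : Vec Bool l} → Exit c a → clock ⟨ a ∷ ls , balanced , [] ⟩ ≡ clock ⟨ ls , c , [] ⟩ ℤ.+ + 1
clock-discover {c} {a} {ls = ls} e = trans (cong (λ t → clockOf (t ℤ.+ (+ moment ls ℤ.+ + ones ls)) 0ℤ (t ℤ.+ + ones ls ℤ.- + 0 ℤ.+ + 0)) (tilt-exit e))
  (identity (tilt c) (+ ones ls) (+ moment ls))
  where
  identity : ∀ t A p → + 2 ℤ.* (t ℤ.+ + 1 ℤ.+ (p ℤ.+ A) ℤ.+ + 0) ℤ.- (t ℤ.+ + 1 ℤ.+ A ℤ.- + 0 ℤ.+ + 0) ℤ.* (t ℤ.+ + 1 ℤ.+ A ℤ.- + 0 ℤ.+ + 0)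
    ≡ + 2 ℤ.* (p ℤ.+ + 0) ℤ.- (A ℤ.- + 0 ℤ.+ t) ℤ.* (A ℤ.- + 0 ℤ.+ t) ℤ.+ + 1
  identity = ℤ-Solver.solve-∀

clock-proceed : ∀ {c a l r} b {ls : Vec Bool l} {rs : Vec Bool r} → Exit c a →
  clock ⟨ a ∷ ls , opposite (trail b) , rs ⟩ ≡ clock ⟨ ls , c , b ∷ rs ⟩ ℤ.+ + 1
clock-proceed {c} {a} b {ls} {rs} e = trans
  (cong₂ (λ t u → clockOf (t ℤ.+ (+ moment ls ℤ.+ + ones ls)) (+ moment rs) (t ℤ.+ + ones ls ℤ.- + ones rs ℤ.+ u)) (tilt-exit e) (tilt-face b))
  (identity (tilt c) (+ bit b) (+ ones ls) (+ ones rs) (+ moment ls) (+ moment rs))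
  where
  tilt-face : ∀ b → tilt (opposite (trail b)) ≡ ℤ.- + bit b
  tilt-face true  = refl
  tilt-face false = refl
  identity : ∀ t b A B p q →
    + 2 ℤ.* (t ℤ.+ + 1 ℤ.+ (p ℤ.+ A) ℤ.+ q) ℤ.- (t ℤ.+ + 1 ℤ.+ A ℤ.- B ℤ.+ ℤ.- b) ℤ.* (t ℤ.+ + 1 ℤ.+ A ℤ.- B ℤ.+ ℤ.- b)
    ≡ + 2 ℤ.* (p ℤ.+ (b ℤ.+ (q ℤ.+ B))) ℤ.- (A ℤ.- (b ℤ.+ B) ℤ.+ t) ℤ.* (A ℤ.- (b ℤ.+ B) ℤ.+ t) ℤ.+ + 1
  identity = ℤ-Solver.solve-∀

clock-flip : ∀ {l r} (ls : Vec Bool l) c (rs : Vec Bool r) → clock ⟨ rs , opposite c , ls ⟩ ≡ clock ⟨ ls , c , rs ⟩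
clock-flip ls c rs = trans (cong (λ t → clockOf (+ moment rs) (+ moment ls) (+ ones rs ℤ.- + ones ls ℤ.+ t)) (tilt-opposite c))
  (identity (tilt c) (+ ones ls) (+ ones rs) (+ moment ls) (+ moment rs))
  where
  tilt-opposite : ∀ c → tilt (opposite c) ≡ ℤ.- tilt c
  tilt-opposite balanced = refl
  tilt-opposite forward  = refl
  tilt-opposite backward = refl
  identity : ∀ t A B p q → + 2 ℤ.* (q ℤ.+ p) ℤ.- (B ℤ.- A ℤ.+ ℤ.- t) ℤ.* (B ℤ.- A ℤ.+ ℤ.- t)
    ≡ + 2 ℤ.* (p ℤ.+ q) ℤ.- (A ℤ.- B ℤ.+ t) ℤ.* (A ℤ.- B ℤ.+ t)
  identity = ℤ-Solver.solve-∀

moment-bound : ∀ {l} (bs : Vec Bool l) → moment bs ℕ.≤ l ℕ.* l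
moment-bound []       = z≤n
moment-bound {suc l} (b ∷ bs) = begin
  bit b ℕ.+ (moment bs ℕ.+ ones bs)   ≤⟨ ℕ.+-mono-≤ (bit≤1 b) (ℕ.+-mono-≤ (moment-bound bs) (ones-bound bs)) ⟩
  1 ℕ.+ (l ℕ.* l ℕ.+ l)               ≤⟨ s≤s (ℕ.≤-trans (ℕ.≤-reflexive (ℕ.+-comm (l ℕ.* l) l)) (ℕ.+-monoʳ-≤ l (ℕ.*-monoʳ-≤ l (ℕ.n≤1+n l)))) ⟩
  suc l ℕ.* suc l                     ∎
  where
  open ℕ.≤-Reasoning
  bit≤1 : ∀ b → bit b ℕ.≤ 1
  bit≤1 true  = s≤s z≤n
  bit≤1 false = z≤n
  ones-bound : ∀ {l} (bs : Vec Bool l) → ones bs ℕ.≤ l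
  ones-bound []       = z≤n
  ones-bound (b ∷ bs) = ℕ.+-mono-≤ (bit≤1 b) (ones-bound bs)

square-nonNegative : ∀ i → 0ℤ ℤ.≤ i ℤ.* i
square-nonNegative (+ k)    = subst (0ℤ ℤ.≤_) (ℤ.pos-* k k) (ℤ.+≤+ z≤n)
square-nonNegative -[1+ k ] = ℤ.+≤+ z≤n

clock-bound : ∀ {n l r} (ls : Vec Bool l) c (rs : Vec Bool r) → l ℕ.+ r ℕ.≤ n → clock ⟨ ls , c , rs ⟩ ℤ.≤ + (2 ℕ.* (n ℕ.* n ℕ.+ n ℕ.* n))
clock-bound {n} {l} {r} ls c rs l+r≤n = begin
  + 2 ℤ.* + (moment ls ℕ.+ moment rs) ℤ.- s ℤ.* s      ≤⟨ ℤ.+-monoʳ-≤ (+ 2 ℤ.* + (moment ls ℕ.+ moment rs)) (ℤ.neg-mono-≤ (square-nonNegative s)) ⟩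
  + 2 ℤ.* + (moment ls ℕ.+ moment rs) ℤ.- 0ℤ           ≡⟨ ℤ.+-identityʳ _ ⟩
  + 2 ℤ.* + (moment ls ℕ.+ moment rs)                  ≡⟨ ℤ.pos-* 2 (moment ls ℕ.+ moment rs) ⟨
  + (2 ℕ.* (moment ls ℕ.+ moment rs))                  ≤⟨ ℤ.+≤+ (ℕ.*-monoʳ-≤ 2 (ℕ.+-mono-≤
    (ℕ.≤-trans (moment-bound ls) (ℕ.*-mono-≤ l≤n l≤n)) (ℕ.≤-trans (moment-bound rs) (ℕ.*-mono-≤ r≤n r≤n)))) ⟩
  + (2 ℕ.* (n ℕ.* n ℕ.+ n ℕ.* n)) ∎
  where
  open ℤ.≤-Reasoning
  s = + ones ls ℤ.- + ones rs ℤ.+ tilt c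
  l≤n = ℕ.≤-trans (ℕ.m≤m+n l r) l+r≤n
  r≤n = ℕ.≤-trans (ℕ.m≤n+m r l) l+r≤n

module _ (n : ℕ) where

  horizon : ℕ
  horizon = 2 ℕ.* (n ℕ.* n ℕ.+ n ℕ.* n)

  -- Each move raises the clock by one and lowers m by one, so their sum is preserved. An uncovered
  -- state with m = 0 would then violate `clock-bound`.
  negSurvival-vanishes : ∀ m d {l r} (ls : Vec Bool l) c (rs : Vec Bool r) → l ℕ.+ r ℕ.+ d ≡ n →
    + horizon ℤ.< clock ⟨ ls , c , rs ⟩ ℤ.+ + m → negSurvival m d ⟨ ls , c , rs ⟩ ≡ 0ℚ
  negSurvival-vanishes m       zero    ls c rs eq late = refl
  negSurvival-vanishes zero    (suc d) ls c rs eq late =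
    contradiction (ℤ.<-≤-trans late (subst (ℤ._≤ + horizon) (sym (ℤ.+-identityʳ _)) (clock-bound ls c rs (ℕ.<⇒≤ (incomplete eq))))) (ℤ.<-irrefl refl)
  negSurvival-vanishes (suc m) (suc d) ls c rs eq late = moves c ls rs eq late
    where
    later-by-one : ∀ {σ τ} → clock τ ≡ clock σ ℤ.+ + 1 → + horizon ℤ.< clock σ ℤ.+ + suc m → + horizon ℤ.< clock τ ℤ.+ + m
    later-by-one {σ} tick late = subst (+ horizon ℤ.<_) (trans (sym (ℤ.+-assoc (clock σ) (+ 1) (+ m))) (cong (ℤ._+ + m) (sym tick))) late
    forwards : ∀ {c a l r} (ls : Vec Bool l) (rs : Vec Bool r) → Exit c a → l ℕ.+ r ℕ.+ suc d ≡ n →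
      + horizon ℤ.< clock ⟨ ls , c , rs ⟩ ℤ.+ + suc m → goForward (negSurvival m) d (a ∷ ls) rs ≡ 0ℚ
    forwards {c} {a} {l} ls [] e eq late =
      negSurvival-vanishes m d (a ∷ ls) balanced [] (trans (sym (ℕ.+-suc (l ℕ.+ 0) d)) eq)
        (later-by-one {⟨ ls , c , [] ⟩} {⟨ a ∷ ls , balanced , [] ⟩} (clock-discover {ls = ls} e) late)
    forwards {c} {a} {l} {suc r} ls (b ∷ rs) e eq late =
      negSurvival-vanishes m (suc d) (a ∷ ls) (opposite (trail b)) rs (trans (cong (ℕ._+ suc d) (sym (ℕ.+-suc l r))) eq)
        (later-by-one {⟨ ls , c , b ∷ rs ⟩} {⟨ a ∷ ls , opposite (trail b) , rs ⟩} (clock-proceed b {ls} {rs} e) late)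
    backwards : ∀ c {a l r} (ls : Vec Bool l) (rs : Vec Bool r) → Exit (opposite c) a → l ℕ.+ r ℕ.+ suc d ≡ n →
      + horizon ℤ.< clock ⟨ ls , c , rs ⟩ ℤ.+ + suc m → goBackward (negSurvival m) d ls (a ∷ rs) ≡ 0ℚ
    backwards c {a} {r = r} [] rs e eq late =
      negSurvival-vanishes m d [] balanced (a ∷ rs) (trans (sym (ℕ.+-suc r d)) eq)
        (later-by-one {⟨ [] , c , rs ⟩} {⟨ [] , balanced , a ∷ rs ⟩}
          (trans (clock-flip (a ∷ rs) balanced []) (trans (clock-discover {ls = rs} e) (cong (ℤ._+ + 1) (clock-flip [] c rs)))) late)
    backwards c {a} {suc l} {r} (b ∷ ls) rs e eq late =
      negSurvival-vanishes m (suc d) ls (trail b) (a ∷ rs) (trans (cong (ℕ._+ suc d) (ℕ.+-suc l r)) eq)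
        (later-by-one {⟨ b ∷ ls , c , rs ⟩} {⟨ ls , trail b , a ∷ rs ⟩}
          (trans (sym (clock-flip ls (trail b) (a ∷ rs))) (trans (clock-proceed b {rs} {ls} e) (cong (ℤ._+ + 1) (clock-flip (b ∷ ls) c rs)))) late)
    moves : ∀ c {l r} (ls : Vec Bool l) (rs : Vec Bool r) → l ℕ.+ r ℕ.+ suc d ≡ n →
      + horizon ℤ.< clock ⟨ ls , c , rs ⟩ ℤ.+ + suc m → next (negSurvival m) d ⟨ ls , c , rs ⟩ ≡ 0ℚ
    moves balanced ls rs eq late = cong₂ (λ f b → ½ * f + ½ * b)
      (forwards ls rs from-balanced eq late) (backwards balanced ls rs from-balanced eq late)
    moves forward  ls rs eq late = backwards forward ls rs from-backward eq late
    moves backward ls rs eq late = forwards ls rs from-backward eq late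

-- Expected cover time under negative feedback

sum-stable : ∀ (f : ℕ → ℚ) M₀ → (∀ m → M₀ ℕ.≤ m → f m ≡ 0ℚ) → ∀ M → M₀ ℕ.≤ M → sumℚ (applyUpTo f M) ≡ sumℚ (applyUpTo f M₀)
sum-stable f zero     zeros zero    _ = refl
sum-stable f zero     zeros (suc M) _ = trans (cong₂ _+_ (zeros 0 z≤n) (sum-stable (f ∘ suc) 0 (λ m _ → zeros (suc m) z≤n) M z≤n)) (+-identityˡ 0ℚ)
sum-stable f (suc M₀) zeros (suc M) (s≤s M₀≤M) = cong (λ t → f 0 + t) (sum-stable (f ∘ suc) M₀ (λ m M₀≤m → zeros (suc m) (s≤s M₀≤m)) M M₀≤M)

converges-eventually-constant : ∀ (s : ℕ → ℚ) {L} M₀ → (∀ M → M₀ ℕ.≤ M → s M ≡ L) → ConvergesTo s L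
converges-eventually-constant s {L} M₀ const ε 0<ε = M₀ , λ M M₀≤M →
  subst (_< ε) (sym (cong ∣_∣ (trans (cong (λ t → t - L) (const M M₀≤M)) (+-inverseʳ L)))) 0<ε

coverTime-neg : ∀ n → 2 ℕ.≤ n → Σ ℚ (λ L → ExpectedCoverTime {n} πneg L × L < + (suc n ℕ.* n) / 2)
coverTime-neg n 2≤n = L ,
  -- The clock starts at 0, so it must have passed `horizon n` after `suc (horizon n)` steps.
  converges-eventually-constant (partialE πneg) (suc (horizon n)) (λ M M₀≤M → trans (partial M) (sum-stable f (suc (horizon n)) vanishes M M₀≤M)) ,
  -- L plus a nonnegative remainder equals e 0, the mass of G, which lies strictly below
  -- `later 0 n`.
  ≤-<-trans (subst₂ _≤_ (+-identityʳ L) (telescope f e (λ m → total-balance m 0 n) (suc (horizon n)))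
      (+-monoʳ-≤ L (total-nonNegative (suc (horizon n)) 0 n)))
    (subst (total 0 n (negSurvival 0) <_) (trans (cong ι (sym (remaining-later n))) (remaining-start n)) (total-one-strict n 2≤n))
  where
  f e : ℕ → ℚ
  f m = negSurvival m n ⟨ [] , balanced , [] ⟩
  e m = total 0 n (negSurvival m)
  L = sumℚ (applyUpTo f (suc (horizon n)))
  vanishes : ∀ m → suc (horizon n) ℕ.≤ m → f m ≡ 0ℚ
  vanishes m late = negSurvival-vanishes n m n [] balanced [] refl (ℤ.+<+ late)
  start : Configuration {n} succC predC (zero ∷ []) zero [] balanced []
  start = record { arc = arc-start ; centre = refl ; left = tt ; right = tt }
  partial : ∀ M → partialE {n} πneg M ≡ sumℚ (applyUpTo f M)
  partial M = trans (partialE-survival πneg M) (sum-cong (λ m → survival-neg 2≤n m n refl start) M)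

theorem5 : (n : ℕ) → 2 ℕ.≤ n →
    Σ ℚ (λ L → ExpectedCoverTime {n} πneg L × L < + (suc n ℕ.* n) / 2)
    × ExpectedCoverTime {n} πrw (+ (suc n ℕ.* n) / 2)
theorem5 n 2≤n = coverTime-neg n 2≤n , coverTime-rw n
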